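{- For every even integer $k \geq 4$, every positive integer $u \equiv 1 \pmod k$ and every integer $g \geq 2$, there exists a $k$-ARCS of $(K_u \times K_g)(2)$.
   Context: For graphs $G,H$, the tensor product $G \times H$ has vertex set $V(G)\times V(H)$, with $(g_1,h_1)$ adjacent to $(g_2,h_2)$ iff $g_1g_2 \in E(G)$ and $h_1h_2 \in E(H)$. For a graph $G$ and positive integer $\lambda$, $G(\lambda)$ is the multigraph obtained by replacing each edge of $G$ by $\lambda$ parallel edges. $K_n$ is the complete graph on $n$ vertices. $(K_u \times K_g)(\lambda)$ is regarded as a $u$-partite multigraph with partite sets $V_i = \{i\}\times V(K_g)$, $i=1,\dots,u$. A partial $C_k$-factor of $(K_u \times K_g)(\lambda)$ is a subgraph which, for some $i$, is a spanning subgraph of $(K_u \times K_g)(\lambda)\setminus V_i$ all of whose components are cycles of length $k$. A $k$-ARCS of $(K_u \times K_g)(\lambda)$ is a partition of its edge multiset into partial $C_k$-factors. -}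

module Defs where

open import Data.Nat using (ℕ; zero; suc; _+_; _≤_)
open import Data.Fin using (Fin)
import Data.Fin.Properties as FinP
open import Data.Product using (_×_; _,_; proj₁; proj₂)
import Data.Product.Properties as ProdP
open import Data.List using (List; []; _∷_; _++_; [_]; zip; length; filter; concat; map)
open import Data.Nat.ListAction using (sum)
open import Data.List.Relation.Unary.All using (All)
open import Relation.Binary.PropositionalEquality using (_≡_; _≢_)
open import Relation.Binary.Definitions using (DecidableEquality)
open import Relation.Nullary using (yes; no)
open import Relation.Nullary.Decidable using (_⊎-dec_)
open import Data.Sum using (_⊎_)

-- Vertices of K_u × K_g : pairs (i , a), with i the index of the partite set V_i.
Vertex : ℕ → ℕ → Set
Vertex u g = Fin u × Fin g

_≟V_ : ∀ {u g} → DecidableEquality (Vertex u g)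
_≟V_ = ProdP.≡-dec FinP._≟_ FinP._≟_

Adj : ∀ {u g} → Vertex u g → Vertex u g → Set
Adj (i , a) (j , b) = (i ≢ j) × (a ≢ b)

occ : ∀ {u g} → Vertex u g → List (Vertex u g) → ℕ
occ v xs = length (filter (λ w → w ≟V v) xs)

cycEdges : ∀ {u g} → List (Vertex u g) → List (Vertex u g × Vertex u g)
cycEdges [] = []
cycEdges (x ∷ xs) = zip (x ∷ xs) (xs ++ [ x ])

record IsCycle {u g : ℕ} (k : ℕ) (vs : List (Vertex u g)) : Set where
  field
    len      : length vs ≡ k
    distinct : ∀ v → occ v vs ≤ 1
    adjacent : All (λ e → Adj (proj₁ e) (proj₂ e)) (cycEdges vs)

edgeMult : ∀ {u g} → Vertex u g → Vertex u g → List (Vertex u g) → ℕ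
edgeMult x y vs =
  length (filter (λ e → (e ≟E (x , y)) ⊎-dec (e ≟E (y , x))) (cycEdges vs))
  where
  _≟E_ = ProdP.≡-dec _≟V_ _≟V_

record PartialFactor (u g k : ℕ) : Set where
  field
    hole    : Fin u
    cycles  : List (List (Vertex u g))
    isCycle : All (IsCycle k) cycles
    cover   : ∀ (v : Vertex u g) →
                (proj₁ v ≡ hole → occ v (concat cycles) ≡ 0) ×
                (proj₁ v ≢ hole → occ v (concat cycles) ≡ 1)

open PartialFactor public

factorMult : ∀ {u g k} → Vertex u g → Vertex u g → PartialFactor u g k → ℕ
factorMult x y F = sum (map (edgeMult x y) (cycles F))

-- A k-ARCS of (K_u × K_g)(λ): a list of partial C_k-factors such that every
-- edge {x,y} of K_u × K_g is used exactly λ times in total (cycles only use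
-- edges of K_u × K_g, by IsCycle.adjacent).
record ARCS (u g k λ' : ℕ) : Set where
  field
    factors   : List (PartialFactor u g k)
    partition : ∀ (x y : Vertex u g) → Adj x y →
                  sum (map (factorMult x y) factors) ≡ λ'

{-# OPTIONS --safe #-}
module Submission where

-- Call a near k-cycle factorisation of a vertex set V a family, indexed by the
-- vertices i of V, of partitions of V ∖ {i} into directed k-cycles that together
-- use every ordered pair of distinct vertices exactly once.  Since k is even, each
-- of its cycles v₀ v₁ v₂ … lifts, for every nonzero d in ℤ/g, to the g cycles
-- (v₀, a) (v₁, a+d) (v₂, a) (v₃, a+d) …, and these lifts form the required k-ARCS.
--
-- It remains to find near k-cycle factorisations on 1 + t k points, where k = 2m.
-- For t = 1 the points are ℤ/k and ∞, and for t = 2 they are ℤ/(2k+1); both times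
-- the cycles are translates of zigzags with all differences distinct.  Larger t are
-- reached by a product: a factorisation on 1 + w k points yields one on 1 + n w k
-- points whenever there is a 1-frame of type 2ⁿ, because the complete bipartite
-- digraph on m + m points splits into m directed Hamiltonian cycles.  Such frames
-- exist for n odd (x ↦ 2b − x on ℤ/n) and for n = 4, which covers all t.

open import Defs
open import Data.Bool using (true; false; if_then_else_)
open import Data.Fin as Fin using (Fin; toℕ; fromℕ<; punchIn; punchOut; combine; remQuot; splitAt; _↑ˡ_; _↑ʳ_)
import Data.Fin.Properties as FinP
open import Data.Integer using (ℤ; +_; -[1+_]; _+_; _*_; _-_; -_)
open import Data.Integer.DivMod using (_/ℕ_; n%ℕd<d; a≡a%ℕn+[a/ℕn]*n)
import Data.Integer.Properties as ℤP
open import Data.Integer.Tactic.RingSolver using (solve-∀)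
open import Data.List using (List; []; _∷_; [_]; _++_; length; filter; concat; map; zip; applyUpTo; cartesianProduct; allFin)
open import Data.List.Membership.Propositional using (_∈_; _∉_)
open import Data.List.Membership.Propositional.Properties using (∈-map⁺; ∈-map⁻; ∈-∃++; ∈-concat⁺′; ∈-cartesianProduct⁺; ∈-allFin; ∈-applyUpTo⁺)
import Data.List.Properties as ListP
open import Data.List.Relation.Binary.Permutation.Propositional using (_↭_; ↭-trans; ↭-refl; prep)
import Data.List.Relation.Binary.Permutation.Propositional.Properties as ↭P
open import Data.List.Relation.Unary.All as All using ()
open import Data.List.Relation.Unary.AllPairs using ([]; _∷_)
open import Data.List.Relation.Unary.Any using (here; there)
open import Data.List.Relation.Unary.Unique.Propositional using (Unique)
import Data.List.Relation.Unary.Unique.Propositional.Properties as UniqueP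
open import Data.Maybe as Maybe using (Maybe; just; nothing)
open import Data.Nat as ℕ using (ℕ; zero; suc; _≤_; _<_; z≤n; s≤s; NonZero; _<ᵇ_)
open import Data.Nat.Divisibility using (_∣_; divides)
open import Data.Nat.DivMod using (_mod_)
open import Data.Nat.Induction using (<-rec)
open import Data.Nat.ListAction using (sum)
import Data.Nat.Properties as ℕP
import Data.Nat.Tactic.RingSolver as ℕ-Solver
open import Data.Product using (∃-syntax; _×_; _,_; proj₁; proj₂; swap)
open import Data.Product.Function.NonDependent.Propositional using (_×-↔_)
import Data.Product.Properties as ProdP
open import Data.Sum using (_⊎_; inj₁; inj₂; [_,_]′)
open import Function using (_∘_; _↔_; Inverse; mk↔ₛ′)
open import Function.Properties.Inverse using (↔-refl; ↔-sym; ↔-trans)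
open import Level using (0ℓ)
open import Relation.Binary.Definitions using (DecidableEquality; Tri; tri<; tri≈; tri>)
open import Relation.Binary.PropositionalEquality using (_≡_; _≢_; refl; sym; trans; cong; cong₂; subst; subst₂; module ≡-Reasoning)
open import Relation.Nullary using (¬_; contradiction; yes; no)
open import Relation.Nullary.Decidable using (toWitness; ¬?; _→-dec_; _×-dec_; _⊎-dec_)
open import Relation.Unary using (Pred; Decidable)

private variable
  A B V W : Set

-- Residues

-- A positive `c` would make `r` at least `n`; a negative `c` becomes positive once `r` and `s` are
-- exchanged.
remainder-unique : ∀ {n r s} c → r < n → s < n → + r ≡ + s + c * + n → r ≡ s
remainder-unique {n} {r} {s} (+ c) r<n s<n e = go c (ℤP.+-injective (trans e (cong (_+_ (+ s)) (sym (ℤP.pos-* c n)))))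
  where
  go : ∀ c → r ≡ s ℕ.+ c ℕ.* n → r ≡ s
  go zero    e = trans e (ℕP.+-identityʳ s)
  go (suc c) e = contradiction r<n
    (ℕP.≤⇒≯ (subst (n ≤_) (sym e) (ℕP.≤-trans (ℕP.m≤m+n n (c ℕ.* n)) (ℕP.m≤n+m _ s))))
remainder-unique {n} {r} {s} -[1+ c ] r<n s<n e =
  sym (remainder-unique (+ suc c) s<n r<n (trans (shift (+ s) (+ suc c * + n)) (cong (_+ (+ suc c * + n)) (sym e'))))
  where
  shift : ∀ a b → a ≡ (a - b) + b
  shift = solve-∀
  e' : + r ≡ + s - + suc c * + n
  e' = trans e (cong (_+_ (+ s)) (sym (ℤP.neg-distribˡ-* (+ suc c) (+ n))))

module Residue (n : ℕ) .{{_ : NonZero n}} where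

  -- Abstract so that a can be inferred from ⟦ a ⟧.
  abstract
    ⟦_⟧ : ℤ → Fin n
    ⟦ a ⟧ = fromℕ< (n%ℕd<d a n)

    ⟦⟧-rep : ∀ a → ∃[ c ] a ≡ + toℕ ⟦ a ⟧ + c * + n
    ⟦⟧-rep a = a /ℕ n , trans (a≡a%ℕn+[a/ℕn]*n a n)
      (cong (λ r → + r + (a /ℕ n) * + n) (sym (FinP.toℕ-fromℕ< (n%ℕd<d a n))))

  ⟦⟧-eq : ∀ {a b} c → a ≡ b + c * + n → ⟦ a ⟧ ≡ ⟦ b ⟧
  ⟦⟧-eq {a} {b} c e with ⟦⟧-rep a | ⟦⟧-rep b
  ... | p , ea | q , eb = FinP.toℕ-injective
    (remainder-unique (q + c - p) (FinP.toℕ<n ⟦ a ⟧) (FinP.toℕ<n ⟦ b ⟧) eq)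
    where
    open ≡-Reasoning
    N = + n
    r = + toℕ ⟦ a ⟧
    s = + toℕ ⟦ b ⟧
    s₁ : ∀ r x → r ≡ (r + x) - x
    s₁ = solve-∀
    s₂ : ∀ s q c p N → ((s + q * N) + c * N) - p * N ≡ s + (q + c - p) * N
    s₂ = solve-∀
    eq : r ≡ s + (q + c - p) * N
    eq = begin
      r                              ≡⟨ s₁ r (p * N) ⟩
      (r + p * N) - p * N            ≡⟨ cong (_- p * N) (sym ea) ⟩
      a - p * N                      ≡⟨ cong (_- p * N) e ⟩
      (b + c * N) - p * N            ≡⟨ cong (λ z → (z + c * N) - p * N) eb ⟩
      ((s + q * N) + c * N) - p * N  ≡⟨ s₂ s q c p N ⟩
      s + (q + c - p) * N            ∎

  ⟦⟧-toℕ : ∀ x → ⟦ + toℕ x ⟧ ≡ x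
  ⟦⟧-toℕ x with ⟦⟧-rep (+ toℕ x)
  ... | c , e = sym (FinP.toℕ-injective (remainder-unique c (FinP.toℕ<n x) (FinP.toℕ<n ⟦ + toℕ x ⟧) e))

  -- Both arguments equal their common remainder up to multiples of `n`, and the hypothesis says
  -- that `f` respects adding such multiples.
  ⟦⟧-cong : ∀ {a b} (f : ℤ → ℤ) → (∀ x c → ∃[ d ] f (x + c * + n) ≡ f x + d * + n) →
            ⟦ a ⟧ ≡ ⟦ b ⟧ → ⟦ f a ⟧ ≡ ⟦ f b ⟧
  ⟦⟧-cong {a} {b} f h e with ⟦⟧-rep a | ⟦⟧-rep b
  ... | p , ea | q , eb = begin
    ⟦ f a ⟧                              ≡⟨ cong (⟦_⟧ ∘ f) ea ⟩
    ⟦ f (+ toℕ ⟦ a ⟧ + p * + n) ⟧        ≡⟨ ⟦⟧-eq (proj₁ (h (+ toℕ ⟦ a ⟧) p)) (proj₂ (h (+ toℕ ⟦ a ⟧) p)) ⟩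
    ⟦ f (+ toℕ ⟦ a ⟧) ⟧                  ≡⟨ cong (λ x → ⟦ f (+ toℕ x) ⟧) e ⟩
    ⟦ f (+ toℕ ⟦ b ⟧) ⟧                  ≡⟨ sym (⟦⟧-eq (proj₁ (h (+ toℕ ⟦ b ⟧) q)) (proj₂ (h (+ toℕ ⟦ b ⟧) q))) ⟩
    ⟦ f (+ toℕ ⟦ b ⟧ + q * + n) ⟧        ≡⟨ cong (⟦_⟧ ∘ f) (sym eb) ⟩
    ⟦ f b ⟧                              ∎
    where open ≡-Reasoning

  ⟦⟧-+ˡ : ∀ {a b} c → ⟦ a ⟧ ≡ ⟦ b ⟧ → ⟦ c + a ⟧ ≡ ⟦ c + b ⟧
  ⟦⟧-+ˡ c = ⟦⟧-cong (_+_ c) (λ x d → d , sym (ℤP.+-assoc c x _))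

  ⟦⟧-+ʳ : ∀ {a b} c → ⟦ a ⟧ ≡ ⟦ b ⟧ → ⟦ a + c ⟧ ≡ ⟦ b + c ⟧
  ⟦⟧-+ʳ c = ⟦⟧-cong (_+ c) (λ x d → d , s x d c (+ n))
    where
    s : ∀ x d c N → (x + d * N) + c ≡ (x + c) + d * N
    s = solve-∀

  ⟦⟧-neg : ∀ {a b} → ⟦ a ⟧ ≡ ⟦ b ⟧ → ⟦ - a ⟧ ≡ ⟦ - b ⟧
  ⟦⟧-neg = ⟦⟧-cong -_ (λ x d → - d , s x d (+ n))
    where
    s : ∀ x d N → - (x + d * N) ≡ - x + (- d) * N
    s = solve-∀

  ⟦⟧-difference : ∀ {x y : Fin n} {r} → toℕ ⟦ + toℕ y - + toℕ x ⟧ ≡ r → ⟦ + toℕ x + + r ⟧ ≡ y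
  ⟦⟧-difference {x} {y} refl = trans (⟦⟧-+ˡ (+ toℕ x) (⟦⟧-toℕ _)) (trans (cong ⟦_⟧ (s (+ toℕ x) (+ toℕ y))) (⟦⟧-toℕ y))
    where
    s : ∀ a b → a + (b - a) ≡ b
    s = solve-∀

  offset : ∀ {x y : Fin n} → x ≢ y → ∃[ r ] suc r < n × ⟦ + toℕ x + + suc r ⟧ ≡ y
  offset {x} {y} x≢y with toℕ ⟦ + toℕ y - + toℕ x ⟧ in e
  ... | zero  = contradiction (trans (sym (⟦⟧-toℕ x)) (trans (cong ⟦_⟧ (sym (ℤP.+-identityʳ (+ toℕ x)))) (⟦⟧-difference e))) x≢y
  ... | suc r = r , subst (_< n) e (FinP.toℕ<n _) , ⟦⟧-difference e

  -- Chooses the translate of a base cycle in which the entry `a` falls on `x`; this locates the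
  -- hole of a cycle through a prescribed vertex.
  translate : ∀ (x : Fin n) a → ⟦ + toℕ ⟦ + toℕ x - a ⟧ + a ⟧ ≡ x
  translate x a = trans (⟦⟧-+ʳ a (⟦⟧-toℕ _)) (trans (cong ⟦_⟧ (s (+ toℕ x) a)) (⟦⟧-toℕ x))
    where
    s : ∀ x a → (x - a) + a ≡ x
    s = solve-∀

  -- In that same translate the entry `b` falls on `x + (b - a)`, so an edge is found by looking for
  -- its difference among consecutive entries.
  translate-step : ∀ {y} (x : Fin n) a b c → ⟦ + toℕ x + c ⟧ ≡ y → ⟦ b - a ⟧ ≡ ⟦ c ⟧ → ⟦ + toℕ ⟦ + toℕ x - a ⟧ + b ⟧ ≡ y
  translate-step x a b c e d = trans (⟦⟧-+ʳ b (⟦⟧-toℕ _)) (trans (cong ⟦_⟧ (s (+ toℕ x) a b)) (trans (⟦⟧-+ˡ (+ toℕ x) d) e))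
    where
    s : ∀ x a b → (x - a) + b ≡ x + (b - a)
    s = solve-∀

  reach : ∀ a (x : Fin n) → ∃[ l ] l < n × ⟦ a - + l ⟧ ≡ x
  reach a x = toℕ ⟦ a - + toℕ x ⟧ , FinP.toℕ<n _ ,
    trans (⟦⟧-+ˡ a (⟦⟧-neg (⟦⟧-toℕ _))) (trans (cong ⟦_⟧ (s a (+ toℕ x))) (⟦⟧-toℕ x))
    where
    s : ∀ a x → a + - (a - x) ≡ x
    s = solve-∀

-- Counting in lists

-- Each `y` removes its own occurrence from `xs`, and the length bound leaves nothing behind. Thus
-- covering everything, together with a count, gives covering exactly once.
⊆-length⇒↭ : ∀ {xs ys : List A} → Unique ys → (∀ {y} → y ∈ ys → y ∈ xs) →
             length xs ≤ length ys → xs ↭ ys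
⊆-length⇒↭ {xs = []} {[]} [] _ _ = ↭-refl
⊆-length⇒↭ {ys = y ∷ ys} (y≢ ∷ u) ys⊆xs len
  with ps , qs , refl ← ∈-∃++ (ys⊆xs (here refl)) =
  ↭-trans (↭P.shift y ps qs) (prep y (⊆-length⇒↭ u ys⊆ len′))
  where
  ys⊆ : ∀ {z} → z ∈ ys → z ∈ ps ++ qs
  ys⊆ z∈ with ↭P.∈-resp-↭ (↭P.shift y ps qs) (ys⊆xs (there z∈))
  ... | here refl = contradiction refl (All.lookup y≢ z∈)
  ... | there z∈′ = z∈′
  len′ : length (ps ++ qs) ≤ length ys
  len′ = ℕ.s≤s⁻¹ (subst (_≤ suc (length ys)) (↭P.↭-length (↭P.shift y ps qs)) len)

module _ {P : Pred A 0ℓ} (P? : Decidable P) where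

  count-concat : ∀ xss → length (filter P? (concat xss)) ≡ sum (map (λ xs → length (filter P? xs)) xss)
  count-concat [] = refl
  count-concat (xs ∷ xss) = begin
    length (filter P? (xs ++ concat xss))
      ≡⟨ cong length (ListP.filter-++ P? xs (concat xss)) ⟩
    length (filter P? xs ++ filter P? (concat xss))
      ≡⟨ ListP.length-++ (filter P? xs) ⟩
    length (filter P? xs) ℕ.+ length (filter P? (concat xss))
      ≡⟨ cong (length (filter P? xs) ℕ.+_) (count-concat xss) ⟩
    length (filter P? xs) ℕ.+ sum (map (λ ys → length (filter P? ys)) xss) ∎
    where open ≡-Reasoning

  count-∈-≤ : ∀ {xs xss} → xs ∈ xss → length (filter P? xs) ≤ length (filter P? (concat xss))
  count-∈-≤ {xs} {xss} xs∈ = subst (length (filter P? xs) ≤_) (sym (count-concat xss)) (go xs∈)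
    where
    go : ∀ {xss} → xs ∈ xss → length (filter P? xs) ≤ sum (map (λ ys → length (filter P? ys)) xss)
    go (here refl) = ℕP.m≤m+n _ _
    go (there p)   = ℕP.≤-trans (go p) (ℕP.m≤n+m _ _)

  count-↭ : ∀ {xs ys} → xs ↭ ys → length (filter P? xs) ≡ length (filter P? ys)
  count-↭ p = ↭P.↭-length (↭P.filter-↭ P? p)

  -- Separates the two orientations of an undirected edge when multiplicities are counted.
  count-⊎ : ∀ {Q : Pred A 0ℓ} (Q? : Decidable Q) → (∀ {x} → P x → ¬ Q x) → ∀ xs →
            length (filter (λ x → P? x ⊎-dec Q? x) xs) ≡ length (filter P? xs) ℕ.+ length (filter Q? xs)
  count-⊎ Q? disj [] = refl
  count-⊎ Q? disj (x ∷ xs) with P? x | Q? x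
  ... | yes p | yes q = contradiction q (disj p)
  ... | yes _ | no _  = cong suc (count-⊎ Q? disj xs)
  ... | no _  | yes _ = trans (cong suc (count-⊎ Q? disj xs)) (sym (ℕP.+-suc _ _))
  ... | no _  | no _  = count-⊎ Q? disj xs

module _ (_≟_ : DecidableEquality A) where

  count-∉ : ∀ {v xs} → v ∉ xs → length (filter (λ w → w ≟ v) xs) ≡ 0
  count-∉ {v} {xs} v∉ = cong length
    (ListP.filter-none (λ w → w ≟ v) (All.tabulate (λ {w} w∈ w≡v → v∉ (subst (_∈ xs) w≡v w∈))))

  count-∈ : ∀ {v xs} → Unique xs → v ∈ xs → length (filter (λ w → w ≟ v) xs) ≡ 1
  count-∈ {v} {x ∷ xs} (x≢ ∷ u) v∈ with x ≟ v | v∈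
  ... | yes refl | _         = cong suc (count-∉ (λ v∈′ → All.lookup x≢ v∈′ refl))
  ... | no x≢v   | here v≡x  = contradiction (sym v≡x) x≢v
  ... | no _     | there v∈′ = count-∈ u v∈′

length-concat-map : ∀ {n} (f : A → List B) → (∀ x → length (f x) ≡ n) → ∀ xs → length (concat (map f xs)) ≡ length xs ℕ.* n
length-concat-map f h [] = refl
length-concat-map f h (x ∷ xs) = trans (ListP.length-++ (f x)) (cong₂ ℕ._+_ (h x) (length-concat-map f h xs))

length-cartesianProduct : ∀ (xs : List A) (ys : List B) → length (cartesianProduct xs ys) ≡ length xs ℕ.* length ys
length-cartesianProduct [] ys = refl
length-cartesianProduct (x ∷ xs) ys =
  trans (ListP.length-++ (map (x ,_) ys)) (cong₂ ℕ._+_ (ListP.length-map _ ys) (length-cartesianProduct xs ys))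

length-allFin : ∀ n → length (allFin n) ≡ n
length-allFin n = ListP.length-tabulate {n = n} (λ i → i)

zip-applyUpTo : ∀ (f : ℕ → A) (g : ℕ → B) n → zip (applyUpTo f n) (applyUpTo g n) ≡ applyUpTo (λ j → f j , g j) n
zip-applyUpTo f g zero    = refl
zip-applyUpTo f g (suc n) = cong ((f 0 , g 0) ∷_) (zip-applyUpTo (f ∘ suc) (g ∘ suc) n)

cycEdges-applyUpTo : ∀ {u g} (f : ℕ → Vertex u g) n → f n ≡ f 0 →
                     cycEdges (applyUpTo f n) ≡ applyUpTo (λ j → f j , f (suc j)) n
cycEdges-applyUpTo f zero    _ = refl
cycEdges-applyUpTo f (suc n) e = begin
  zip (applyUpTo f (suc n)) (applyUpTo (f ∘ suc) n ++ [ f 0 ])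
    ≡⟨ cong (λ v → zip (applyUpTo f (suc n)) (applyUpTo (f ∘ suc) n ++ [ v ])) (sym e) ⟩
  zip (applyUpTo f (suc n)) (applyUpTo (f ∘ suc) n ++ [ f (suc n) ])
    ≡⟨ cong (zip (applyUpTo f (suc n))) (ListP.applyUpTo-∷ʳ (f ∘ suc) n) ⟩
  zip (applyUpTo f (suc n)) (applyUpTo (f ∘ suc) (suc n))
    ≡⟨ zip-applyUpTo f (f ∘ suc) (suc n) ⟩
  applyUpTo (λ j → f j , f (suc j)) (suc n) ∎
  where open ≡-Reasoning

-- Alternating sequences

zig : (ℕ → A) → (ℕ → A) → ℕ → A
zig f g 0             = f 0
zig f g 1             = g 0
zig f g (suc (suc j)) = zig (f ∘ suc) (g ∘ suc) j

zig-even : ∀ (f g : ℕ → A) l → zig f g (l ℕ.* 2) ≡ f l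
zig-even f g zero    = refl
zig-even f g (suc l) = zig-even (f ∘ suc) (g ∘ suc) l

zig-odd : ∀ (f g : ℕ → A) l → zig f g (suc (l ℕ.* 2)) ≡ g l
zig-odd f g zero    = refl
zig-odd f g (suc l) = zig-odd (f ∘ suc) (g ∘ suc) l

data Parity : ℕ → Set where
  even : ∀ l → Parity (l ℕ.* 2)
  odd  : ∀ l → Parity (suc (l ℕ.* 2))

parity : ∀ j → Parity j
parity 0 = even 0
parity 1 = odd 0
parity (suc (suc j)) with parity j
... | even l = even (suc l)
... | odd l  = odd (suc l)

-- Near factorisations and their lifts to `k`-ARCS

-- A near k-cycle factorisation of the complete digraph on V: the cycles missing
-- the vertex i are cyc i c, traversed at times 0, …, k.  Only covering is asked
-- for; when |V| = 1 + t k, covering exactly once follows by counting.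
record Near (k t : ℕ) (V : Set) : Set where
  field
    cyc    : V → Fin t → ℕ → V
    closed : ∀ i c → cyc i c k ≡ cyc i c 0
    find   : ∀ i x → x ≢ i → ∃[ c ] ∃[ j ] j < k × cyc i c j ≡ x
    edge   : ∀ x y → x ≢ y → ∃[ i ] ∃[ c ] ∃[ j ] j < k × cyc i c j ≡ x × cyc i c (suc j) ≡ y

offHole : ∀ {n} g → Fin (suc n) → List (Vertex (suc n) g)
offHole {n} g i = map (λ (j , a) → punchIn i j , a) (cartesianProduct (allFin n) (allFin g))

-- `punchIn` skips the given coordinate, so the adjacent ordered pairs are indexed by a product of
-- `Fin`s, which yields both their number and their distinctness.
toPair : ∀ {n h} → (Fin (suc n) × Fin n) × (Fin (suc h) × Fin h) → Vertex (suc n) (suc h) × Vertex (suc n) (suc h)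
toPair ((i , j) , (a , b)) = (i , a) , (punchIn i j , punchIn a b)

adjPairs : ∀ n h → List (Vertex (suc n) (suc h) × Vertex (suc n) (suc h))
adjPairs n h = map toPair
  (cartesianProduct (cartesianProduct (allFin (suc n)) (allFin n)) (cartesianProduct (allFin (suc h)) (allFin h)))

module _ {n g : ℕ} (i : Fin (suc n)) where

  offHole-unique : Unique (offHole g i)
  offHole-unique = UniqueP.map⁺
    (λ e → cong₂ _,_ (FinP.punchIn-injective i _ _ (cong proj₁ e)) (cong proj₂ e))
    (UniqueP.cartesianProduct⁺ (UniqueP.allFin⁺ n) (UniqueP.allFin⁺ g))

  ∈-offHole⁺ : ∀ {x a} → x ≢ i → (x , a) ∈ offHole g i
  ∈-offHole⁺ {x} {a} x≢i = subst (λ z → (z , a) ∈ offHole g i) (FinP.punchIn-punchOut (x≢i ∘ sym))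
    (∈-map⁺ _ (∈-cartesianProduct⁺ (∈-allFin (punchOut (x≢i ∘ sym))) (∈-allFin a)))

  ∈-offHole⁻ : ∀ {v} → v ∈ offHole g i → proj₁ v ≢ i
  ∈-offHole⁻ v∈ with (j , a) , _ , refl ← ∈-map⁻ _ v∈ = FinP.punchInᵢ≢i i j

  length-offHole : length (offHole g i) ≡ n ℕ.* g
  length-offHole = trans (ListP.length-map _ (cartesianProduct (allFin n) (allFin g)))
    (trans (length-cartesianProduct (allFin n) (allFin g)) (cong₂ ℕ._*_ (length-allFin n) (length-allFin g)))

module _ {n h : ℕ} where

  adjPairs-unique : Unique (adjPairs n h)
  adjPairs-unique = UniqueP.map⁺ inj
    (UniqueP.cartesianProduct⁺ (UniqueP.cartesianProduct⁺ (UniqueP.allFin⁺ _) (UniqueP.allFin⁺ _))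
                               (UniqueP.cartesianProduct⁺ (UniqueP.allFin⁺ _) (UniqueP.allFin⁺ _)))
    where
    inj : ∀ {p q : (Fin (suc n) × Fin n) × (Fin (suc h) × Fin h)} → toPair p ≡ toPair q → p ≡ q
    inj {(i , j) , (a , b)} {(i′ , j′) , (a′ , b′)} e
      with refl ← cong (proj₁ ∘ proj₁) e | refl ← cong (proj₂ ∘ proj₁) e =
      cong₂ (λ j b → (i , j) , (a , b)) (FinP.punchIn-injective i _ _ (cong (proj₁ ∘ proj₂) e))
                                        (FinP.punchIn-injective a _ _ (cong (proj₂ ∘ proj₂) e))

  ∈-adjPairs⁺ : ∀ {x y} → Adj x y → (x , y) ∈ adjPairs n h
  ∈-adjPairs⁺ {i , a} {j , b} (i≢j , a≢b) =
    subst (_∈ adjPairs n h) (cong₂ (λ j b → (i , a) , (j , b)) (FinP.punchIn-punchOut i≢j) (FinP.punchIn-punchOut a≢b))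
      (∈-map⁺ _ (∈-cartesianProduct⁺ (∈-cartesianProduct⁺ (∈-allFin i) (∈-allFin (punchOut i≢j)))
                                     (∈-cartesianProduct⁺ (∈-allFin a) (∈-allFin (punchOut a≢b)))))

  ∈-adjPairs⁻ : ∀ {e} → e ∈ adjPairs n h → Adj (proj₁ e) (proj₂ e)
  ∈-adjPairs⁻ e∈ with ((i , j) , (a , b)) , _ , refl ← ∈-map⁻ _ e∈ =
    FinP.punchInᵢ≢i i j ∘ sym , FinP.punchInᵢ≢i a b ∘ sym

  length-adjPairs : length (adjPairs n h) ≡ (suc n ℕ.* n) ℕ.* (suc h ℕ.* h)
  length-adjPairs = begin
    length (adjPairs n h) ≡⟨ ListP.length-map _ (cartesianProduct P Q) ⟩
    length (cartesianProduct P Q) ≡⟨ length-cartesianProduct P Q ⟩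
    length P ℕ.* length Q ≡⟨ cong₂ ℕ._*_ (len (suc n) n) (len (suc h) h) ⟩
    (suc n ℕ.* n) ℕ.* (suc h ℕ.* h) ∎
    where
    open ≡-Reasoning
    P = cartesianProduct (allFin (suc n)) (allFin n)
    Q = cartesianProduct (allFin (suc h)) (allFin h)
    len : ∀ p q → length (cartesianProduct (allFin p) (allFin q)) ≡ p ℕ.* q
    len p q = trans (length-cartesianProduct (allFin p) (allFin q)) (cong₂ ℕ._*_ (length-allFin p) (length-allFin q))

module Lift {m t h : ℕ} (N : Near (m ℕ.* 2) t (Fin (suc (t ℕ.* (m ℕ.* 2))))) where
  open Near N
  open Residue (suc h)

  k = m ℕ.* 2
  n = t ℕ.* k
  u = suc n
  g = suc h

  shift : Fin h → Fin g → Fin g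
  shift d a = ⟦ + toℕ a + + suc (toℕ d) ⟧

  shift-surjective : ∀ d b → ∃[ a ] shift d a ≡ b
  shift-surjective d b = ⟦ + toℕ b - + suc (toℕ d) ⟧ , translate b (+ suc (toℕ d))

  shift-connects : ∀ a b → a ≢ b → ∃[ d ] shift d a ≡ b
  shift-connects a b a≢b with r , s≤s r<h , e ← offset a≢b =
    fromℕ< r<h , trans (cong (λ r → ⟦ + toℕ a + + suc r ⟧) (FinP.toℕ-fromℕ< r<h)) e

  level : Fin h → Fin g → ℕ → Fin g
  level d a = zig (λ _ → a) (λ _ → shift d a)

  vert : Fin u → Fin h → Fin t × Fin g → ℕ → Vertex u g
  vert i d (c , a) j = cyc i c j , level d a j

  vert-closed : ∀ i d p → vert i d p k ≡ vert i d p 0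
  -- The evenness of `k` enters here: at time `m * 2` the level is back at `a`.
  vert-closed i d (c , a) = cong₂ _,_ (closed i c) (zig-even (λ _ → a) (λ _ → shift d a) m)

  find-vert : ∀ i d x a → x ≢ i → ∃[ p ] ∃[ j ] j < k × vert i d p j ≡ (x , a)
  find-vert i d x a x≢i with find i x x≢i
  ... | c , j , j<k , e with parity j
  ... | even l = (c , a) , l ℕ.* 2 , j<k , cong₂ _,_ e (zig-even (λ _ → a) _ l)
  -- At odd times the level is shifted by `d`, so the lift has to start at the preimage of `a`.
  ... | odd l with b , eb ← shift-surjective d a =
    (c , b) , suc (l ℕ.* 2) , j<k , cong₂ _,_ e (trans (zig-odd (λ _ → b) _ l) eb)

  edge-vert : ∀ x y → Adj x y → ∃[ i ] ∃[ d ] ∃[ p ] ∃[ j ] j < k × (vert i d p j , vert i d p (suc j)) ≡ (x , y)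
  edge-vert (x , a) (y , b) (x≢y , a≢b) with edge x y x≢y
  ... | i , c , j , j<k , ex , ey with parity j
  ... | even l with d , e ← shift-connects a b a≢b =
    i , d , (c , a) , l ℕ.* 2 , j<k ,
    cong₂ _,_ (cong₂ _,_ ex (zig-even (λ _ → a) _ l)) (cong₂ _,_ ey (trans (zig-odd (λ _ → a) _ l) e))
  -- From an odd time the step leads from the shifted level back to the base level, so `d` is the
  -- difference from `b` to `a`.
  ... | odd l with d , e ← shift-connects b a (a≢b ∘ sym) =
    i , d , (c , b) , suc (l ℕ.* 2) , j<k ,
    cong₂ _,_ (cong₂ _,_ ex (trans (zig-odd (λ _ → b) _ l) e)) (cong₂ _,_ ey (zig-even (λ _ → b) (λ _ → shift d b) (suc l)))

  indices : List (Fin t × Fin g)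
  indices = cartesianProduct (allFin t) (allFin g)

  length-indices : length indices ≡ t ℕ.* g
  length-indices = trans (length-cartesianProduct (allFin t) (allFin g)) (cong₂ ℕ._*_ (length-allFin t) (length-allFin g))

  ∈-indices : ∀ p → p ∈ indices
  ∈-indices (c , a) = ∈-cartesianProduct⁺ (∈-allFin c) (∈-allFin a)

  cycle : Fin u → Fin h → Fin t × Fin g → List (Vertex u g)
  cycle i d p = applyUpTo (vert i d p) k

  cycs : Fin u → Fin h → List (List (Vertex u g))
  cycs i d = map (cycle i d) indices

  -- `find-vert` shows that every vertex off the hole is met, and the `t g` cycles of length `k`
  -- have just enough places for one visit each.
  cycs↭offHole : ∀ i d → concat (cycs i d) ↭ offHole g i
  cycs↭offHole i d = ⊆-length⇒↭ (offHole-unique i) ⊆ (ℕP.≤-reflexive len)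
    where
    ⊆ : ∀ {v} → v ∈ offHole g i → v ∈ concat (cycs i d)
    ⊆ {x , a} v∈ with p , j , j<k , refl ← find-vert i d x a (∈-offHole⁻ i v∈) =
      ∈-concat⁺′ (∈-applyUpTo⁺ (vert i d p) j<k) (∈-map⁺ (cycle i d) (∈-indices p))
    arith : ∀ t g k → (t ℕ.* g) ℕ.* k ≡ (t ℕ.* k) ℕ.* g
    arith = ℕ-Solver.solve-∀
    len : length (concat (cycs i d)) ≡ length (offHole g i)
    len = begin
      length (concat (cycs i d)) ≡⟨ length-concat-map (cycle i d) (λ p → ListP.length-applyUpTo _ k) indices ⟩
      length indices ℕ.* k       ≡⟨ cong (ℕ._* k) length-indices ⟩
      (t ℕ.* g) ℕ.* k            ≡⟨ arith t g k ⟩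
      n ℕ.* g                    ≡⟨ sym (length-offHole i) ⟩
      length (offHole g i)       ∎
      where open ≡-Reasoning

  edgesOf : Fin u × Fin h → List (Vertex u g × Vertex u g)
  edgesOf (i , d) = concat (map cycEdges (cycs i d))

  allHoles : List (Fin u × Fin h)
  allHoles = cartesianProduct (allFin u) (allFin h)

  allEdges : List (Vertex u g × Vertex u g)
  allEdges = concat (map edgesOf allHoles)

  length-edgesOf : ∀ q → length (edgesOf q) ≡ (t ℕ.* g) ℕ.* k
  length-edgesOf (i , d) = begin
    length (concat (map cycEdges (cycs i d)))
      ≡⟨ cong (length ∘ concat) (sym (ListP.map-∘ indices)) ⟩
    length (concat (map (cycEdges ∘ cycle i d) indices))
      ≡⟨ length-concat-map (cycEdges ∘ cycle i d) len indices ⟩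
    length indices ℕ.* k
      ≡⟨ cong (ℕ._* k) length-indices ⟩
    (t ℕ.* g) ℕ.* k ∎
    where
    open ≡-Reasoning
    len : ∀ p → length (cycEdges (cycle i d p)) ≡ k
    len p = trans (cong length (cycEdges-applyUpTo (vert i d p) k (vert-closed i d p))) (ListP.length-applyUpTo _ k)

  -- `edge-vert` shows that every adjacent ordered pair is used, and the lengths agree. So each
  -- directed edge is used once, and each undirected edge twice.
  allEdges↭adjPairs : allEdges ↭ adjPairs n h
  allEdges↭adjPairs = ⊆-length⇒↭ adjPairs-unique ⊆ (ℕP.≤-reflexive len)
    where
    ⊆ : ∀ {e} → e ∈ adjPairs n h → e ∈ allEdges
    ⊆ {x , y} e∈ with i , d , p , j , j<k , refl ← edge-vert x y (∈-adjPairs⁻ e∈) =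
      ∈-concat⁺′
        (∈-concat⁺′
          (subst (_ ∈_) (sym (cycEdges-applyUpTo (vert i d p) k (vert-closed i d p)))
            (∈-applyUpTo⁺ (λ j → vert i d p j , vert i d p (suc j)) j<k))
          (∈-map⁺ cycEdges (∈-map⁺ (cycle i d) (∈-indices p))))
        (∈-map⁺ edgesOf (∈-cartesianProduct⁺ (∈-allFin i) (∈-allFin d)))
    arith : ∀ u h t g k → (u ℕ.* h) ℕ.* ((t ℕ.* g) ℕ.* k) ≡ (u ℕ.* (t ℕ.* k)) ℕ.* (g ℕ.* h)
    arith = ℕ-Solver.solve-∀
    len : length allEdges ≡ length (adjPairs n h)
    len = begin
      length allEdges                             ≡⟨ length-concat-map edgesOf length-edgesOf allHoles ⟩
      length allHoles ℕ.* ((t ℕ.* g) ℕ.* k)       ≡⟨ cong (ℕ._* ((t ℕ.* g) ℕ.* k)) (trans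
                                                       (length-cartesianProduct (allFin u) (allFin h))
                                                       (cong₂ ℕ._*_ (length-allFin u) (length-allFin h))) ⟩
      (u ℕ.* h) ℕ.* ((t ℕ.* g) ℕ.* k)             ≡⟨ arith u h t g k ⟩
      (u ℕ.* n) ℕ.* (g ℕ.* h)                     ≡⟨ sym (length-adjPairs {n} {h}) ⟩
      length (adjPairs n h)                       ∎
      where open ≡-Reasoning

  occ-cycs-off : ∀ i d v → proj₁ v ≢ i → occ v (concat (cycs i d)) ≡ 1
  occ-cycs-off i d v v≢i = trans (count-↭ (λ w → w ≟V v) (cycs↭offHole i d)) (count-∈ _≟V_ (offHole-unique i) (∈-offHole⁺ i v≢i))

  occ-cycs-hole : ∀ i d v → proj₁ v ≡ i → occ v (concat (cycs i d)) ≡ 0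
  occ-cycs-hole i d v v≡i = trans (count-↭ (λ w → w ≟V v) (cycs↭offHole i d)) (count-∉ _≟V_ (λ v∈ → ∈-offHole⁻ i v∈ v≡i))

  occ-cycs-≤1 : ∀ i d v → occ v (concat (cycs i d)) ≤ 1
  occ-cycs-≤1 i d v with proj₁ v Fin.≟ i
  ... | yes e = subst (_≤ 1) (sym (occ-cycs-hole i d v e)) z≤n
  ... | no ne = ℕP.≤-reflexive (occ-cycs-off i d v ne)

  factor : Fin u × Fin h → PartialFactor u g k
  factor (i , d) = record
    { hole    = i
    ; cycles  = cycs i d
    ; isCycle = All.tabulate isC
    ; cover   = λ v → occ-cycs-hole i d v , occ-cycs-off i d v
    }
    where
    isC : ∀ {vs} → vs ∈ cycs i d → IsCycle k vs
    isC {vs} vs∈ = record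
      { len      = len vs∈
      ; distinct = λ v → ℕP.≤-trans (count-∈-≤ (λ w → w ≟V v) vs∈) (occ-cycs-≤1 i d v)
      -- Adjacency is also read off the count: the edges of all cycles are a permutation of the
      -- adjacent pairs, which leaves room for no other pair.
      ; adjacent = All.tabulate (λ e∈ → ∈-adjPairs⁻ (↭P.∈-resp-↭ allEdges↭adjPairs
          (∈-concat⁺′ (∈-concat⁺′ e∈ (∈-map⁺ cycEdges vs∈))
            (∈-map⁺ edgesOf (∈-cartesianProduct⁺ (∈-allFin i) (∈-allFin d))))))
      }
      where
      len : ∀ {vs} → vs ∈ cycs i d → length vs ≡ k
      len vs∈ with p , _ , refl ← ∈-map⁻ (cycle i d) vs∈ = ListP.length-applyUpTo _ k

  arcs : ARCS u g k 2
  arcs = record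
    { factors   = map factor allHoles
    ; partition = part
    }
    where
    _≟E_ : DecidableEquality (Vertex u g × Vertex u g)
    _≟E_ = ProdP.≡-dec _≟V_ _≟V_
    part : ∀ x y → Adj x y → sum (map (factorMult x y) (map factor allHoles)) ≡ 2
    part x y adj@(i≢j , a≢b) = begin
      sum (map (factorMult x y) (map factor allHoles))
        ≡⟨ cong sum (trans (sym (ListP.map-∘ allHoles)) (trans (ListP.map-cong inner allHoles) (ListP.map-∘ allHoles))) ⟩
      sum (map mult (map edgesOf allHoles))
        ≡⟨ sym (count-concat E? (map edgesOf allHoles)) ⟩
      mult allEdges
        ≡⟨ count-↭ E? allEdges↭adjPairs ⟩
      mult (adjPairs n h)
        ≡⟨ count-⊎ (_≟E (x , y)) (_≟E (y , x)) disj (adjPairs n h) ⟩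
      length (filter (_≟E (x , y)) (adjPairs n h)) ℕ.+ length (filter (_≟E (y , x)) (adjPairs n h))
        ≡⟨ cong₂ ℕ._+_ (count-∈ _≟E_ adjPairs-unique (∈-adjPairs⁺ adj))
                       (count-∈ _≟E_ adjPairs-unique (∈-adjPairs⁺ (i≢j ∘ sym , a≢b ∘ sym))) ⟩
      2 ∎
      where
      open ≡-Reasoning
      E? = λ e → (e ≟E (x , y)) ⊎-dec (e ≟E (y , x))
      mult : List (Vertex u g × Vertex u g) → ℕ
      mult es = length (filter E? es)
      disj : ∀ {e} → e ≡ (x , y) → ¬ (e ≡ (y , x))
      disj refl e = i≢j (cong (proj₁ ∘ proj₁) e)
      inner : ∀ q → factorMult x y (factor q) ≡ mult (edgesOf q)
      inner (i , d) = trans (cong sum (ListP.map-∘ {g = mult} {f = cycEdges} (cycs i d))) (sym (count-concat E? (map cycEdges (cycs i d))))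

-- One and two cycles

<ᵇ-true : ∀ {i n} → i < n → (i <ᵇ n) ≡ true
<ᵇ-true {i} {n} i<n with i <ᵇ n | ℕP.<⇒<ᵇ i<n
... | true | _ = refl

<ᵇ-false : ∀ {i n} → n ≤ i → (i <ᵇ n) ≡ false
<ᵇ-false {i} {n} n≤i with i <ᵇ n | ℕP.<ᵇ⇒< i n
... | true  | p = contradiction (p _) (ℕP.≤⇒≯ n≤i)
... | false | _ = refl

glue : ℕ → (ℕ → A) → (ℕ → A) → ℕ → A
glue n f g j = if j <ᵇ n then f j else g j

glue-< : ∀ {n j} (f g : ℕ → A) → j < n → glue n f g j ≡ f j
glue-< {j = j} f g j<n = cong (if_then f j else g j) (<ᵇ-true j<n)

glue-≥ : ∀ {n j} (f g : ℕ → A) → n ≤ j → glue n f g j ≡ g j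
glue-≥ {j = j} f g n≤j = cong (if_then f j else g j) (<ᵇ-false n≤j)

-- Forces the value at time `k` to be the initial one, so closure is automatic; the difference
-- across the closing edge is then computed separately.
close : ℕ → (ℕ → A) → ℕ → A
close k w = glue k w (λ _ → w 0)

close-end : ∀ k (w : ℕ → A) → close k w k ≡ w 0
close-end k w = glue-≥ w (λ _ → w 0) ℕP.≤-refl

close-< : ∀ {k j} (w : ℕ → A) → j < k → close k w j ≡ w j
close-< w = glue-< w (λ _ → w 0)

-- Lets the ring solver work under a hypothesis `X ≡ Y`: it proves the goal with the correction
-- `c * (X - Y)`, which vanishes.
by-linear : ∀ {X Y L R : ℤ} c → X ≡ Y → L ≡ R + c * (X - Y) → L ≡ R
by-linear {X} {R = R} c refl e = trans e (s R c X)
  where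
  s : ∀ R c X → R + c * (X - X) ≡ R
  s = solve-∀

*2-double : ∀ l → l ℕ.* 2 ≡ l ℕ.+ l
*2-double = ℕ-Solver.solve-∀

2l<2m : ∀ {l m} → l < m → l ℕ.* 2 < m ℕ.* 2
2l<2m = ℕP.*-monoˡ-< 2

1+2l<2m : ∀ {l m} → l < m → suc (l ℕ.* 2) < m ℕ.* 2
1+2l<2m = ℕP.*-monoˡ-≤ 2

-- Around ∞ the cycle is x ↦ x + 1; around i it is ∞, i+1, i−1, i+2, i−2, …, i+m,
-- whose differences −2, 3, −4, 5, … are all residues but 0 and 1.
near-one : ∀ m → Near (suc m ℕ.* 2) 1 (Maybe (Fin (suc m ℕ.* 2)))
near-one m′ = record { cyc = cyc ; closed = closed ; find = find ; edge = edge }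
  where
  m = suc m′
  k = m ℕ.* 2
  open Residue k

  z : ℕ → ℤ
  z = zig (λ l → + suc l) (λ l → - + suc l)

  z-even : ∀ l → z (l ℕ.* 2) ≡ + suc l
  z-even = zig-even _ _

  z-odd : ∀ l → z (suc (l ℕ.* 2)) ≡ - + suc l
  z-odd = zig-odd (λ l → + suc l) _

  walk : Fin k → ℕ → Maybe (Fin k)
  walk i zero    = nothing
  walk i (suc j) = just ⟦ + toℕ i + z j ⟧

  cyc : Maybe (Fin k) → Fin 1 → ℕ → Maybe (Fin k)
  cyc nothing  _ j = just ⟦ + j ⟧
  cyc (just i) _ j = close k (walk i) j

  walk-at : ∀ i {j x} → suc j < k → ⟦ + toℕ i + z j ⟧ ≡ x → close k (walk i) (suc j) ≡ just x
  walk-at i j<k e = trans (close-< (walk i) j<k) (cong just e)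

  closed : ∀ i c → cyc i c k ≡ cyc i c 0
  closed nothing  _ = cong just (⟦⟧-eq (+ 1) (s (+ k)))
    where
    s : ∀ k → k ≡ + 0 + + 1 * k
    s = solve-∀
  closed (just i) _ = close-end k (walk i)

  find : ∀ i x → x ≢ i → ∃[ c ] ∃[ j ] j < k × cyc i c j ≡ x
  find nothing  nothing  x≢i = contradiction refl x≢i
  find nothing  (just x) x≢i = Fin.zero , toℕ x , FinP.toℕ<n x , cong just (⟦⟧-toℕ x)
  find (just i) nothing  x≢i = Fin.zero , 0 , s≤s z≤n , refl
  find (just i) (just x) x≢i with offset {i} {x} (x≢i ∘ cong just ∘ sym)
  ... | r , r<k , e with r ℕP.<? m
  ... | yes r<m = Fin.zero , suc (r ℕ.* 2) , 1+2l<2m r<m ,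
    walk-at i (1+2l<2m r<m) (trans (cong (λ z → ⟦ + toℕ i + z ⟧) (z-even r)) e)
  -- An offset beyond `m` is `- suc l` modulo `k`, hence an odd-numbered entry of `z`.
  ... | no r≮m with l , eq ← ℕP.m≤n⇒∃[o]m+o≡n r<k =
    Fin.zero , suc (suc (l ℕ.* 2)) , 2l<2m l<m ,
    walk-at i (2l<2m l<m) (trans (cong (λ z → ⟦ + toℕ i + z ⟧) (z-odd l))
      (trans (⟦⟧-eq (- + 1) (by-linear (- + 1) (cong +_ eq) (s (+ toℕ i) (+ l) (+ r) (+ k)))) e))
    where
    eq′ : suc r ℕ.+ suc l ≡ m ℕ.+ m
    eq′ = trans (ℕP.+-suc (suc r) l) (trans eq (*2-double m))
    l<m : suc l < m
    l<m = ℕP.+-cancelˡ-< m (suc l) m (subst (m ℕ.+ suc l <_) eq′ (ℕP.+-monoˡ-≤ (suc l) (s≤s (ℕP.≮⇒≥ r≮m))))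
    s : ∀ i l r k → i + - (+ 1 + l) ≡ (i + (+ 1 + r) + (- + 1) * k) + (- + 1) * ((+ 2 + r + l) - k)
    s = solve-∀

  edge : ∀ x y → x ≢ y → ∃[ i ] ∃[ c ] ∃[ j ] j < k × cyc i c j ≡ x × cyc i c (suc j) ≡ y
  edge nothing  nothing  x≢y = contradiction refl x≢y
  edge nothing  (just y) x≢y = just ⟦ + toℕ y - + 1 ⟧ , Fin.zero , 0 , s≤s z≤n , refl ,
    walk-at _ (s≤s (s≤s z≤n)) (translate y (+ 1))
  -- The last vertex before the return to ∞ is `i + m`, at time `k - 1`.
  edge (just x) nothing  x≢y = just ⟦ + toℕ x - + m ⟧ , Fin.zero , suc (m′ ℕ.* 2) , ℕP.≤-refl ,
    walk-at _ ℕP.≤-refl (trans (cong (λ z → ⟦ + toℕ ⟦ + toℕ x - + m ⟧ + z ⟧) (z-even m′)) (translate x (+ m))) ,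
    close-end k (walk _)
  edge (just x) (just y) x≢y with offset {x} {y} (x≢y ∘ cong just)
  ... | r , r<k , e with parity r
  ... | even zero = nothing , Fin.zero , toℕ x , FinP.toℕ<n x , cong just (⟦⟧-toℕ x) ,
    cong just (trans (cong ⟦_⟧ (ℤP.+-comm (+ 1) (+ toℕ x))) e)
  ... | even (suc l) = just ⟦ + toℕ x - a ⟧ , Fin.zero , suc (suc (l ℕ.* 2)) , ℕP.<⇒≤ r<k ,
    walk-at _ (ℕP.<⇒≤ r<k) (trans (cong (λ z → ⟦ + toℕ ⟦ + toℕ x - a ⟧ + z ⟧) (z-odd l)) (translate x a)) ,
    walk-at _ r<k (trans (cong (λ z → ⟦ + toℕ ⟦ + toℕ x - a ⟧ + z ⟧) (z-even (suc l)))
      (translate-step x a (+ suc (suc l)) _ e (cong ⟦_⟧ eq)))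
    where
    a = - + suc l
    s : ∀ l → (+ 2 + l) - - (+ 1 + l) ≡ + 3 + (l + l)
    s = solve-∀
    eq : + suc (suc l) - a ≡ + suc (suc l ℕ.* 2)
    eq = trans (s (+ l)) (cong (λ x → + (3 ℕ.+ x)) (sym (*2-double l)))
  -- The even difference `2l + 2` is `-2(o + 1)` modulo `k`, the step from `o + 1` to `-(o + 1)`.
  ... | odd l with o , eq ← ℕP.m≤n⇒∃[o]m+o≡n (ℕP.*-cancelʳ-< 2 (suc l) m r<k) =
    just ⟦ + toℕ x - a ⟧ , Fin.zero , suc (o ℕ.* 2) , ℕP.<⇒≤ o<k ,
    walk-at _ (ℕP.<⇒≤ o<k) (trans (cong (λ z → ⟦ + toℕ ⟦ + toℕ x - a ⟧ + z ⟧) (z-even o)) (translate x a)) ,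
    walk-at _ o<k (trans (cong (λ z → ⟦ + toℕ ⟦ + toℕ x - a ⟧ + z ⟧) (z-odd o))
      (translate-step x a (- + suc o) (+ suc (suc (l ℕ.* 2))) e (⟦⟧-eq (- + 1) eqᵢ)))
    where
    a = + suc o
    o<k : suc (suc (o ℕ.* 2)) < k
    o<k = 2l<2m (subst (suc o <_) eq (s≤s (s≤s (ℕP.m≤n+m o l))))
    s : ∀ o l → - (+ 1 + o) - (+ 1 + o) ≡ ((+ 2 + (l + l)) + (- + 1) * ((+ 2 + l + o) + (+ 2 + l + o)))
    s = solve-∀
    eqᵢ : - + suc o - + suc o ≡ + suc (suc (l ℕ.* 2)) + (- + 1) * + k
    eqᵢ = trans (s (+ o) (+ l)) (cong₂ (λ x y → + (2 ℕ.+ x) + (- + 1) * + y) (sym (*2-double l))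
      (trans (cong₂ ℕ._+_ eq eq) (sym (*2-double m))))

sgn : Fin 2 → ℤ → ℤ
sgn Fin.zero    x = x
sgn (Fin.suc _) x = - x

flip : Fin 2 → Fin 2
flip Fin.zero    = Fin.suc Fin.zero
flip (Fin.suc _) = Fin.zero

sgn-flip : ∀ c x → sgn (flip c) x ≡ - sgn c x
sgn-flip Fin.zero    x = refl
sgn-flip (Fin.suc _) x = sym (ℤP.neg-involutive x)

sgn-- : ∀ c x y → sgn c x - sgn c y ≡ sgn c (x - y)
sgn-- Fin.zero    x y = refl
sgn-- (Fin.suc _) x y = s x y
  where
  s : ∀ x y → - x - - y ≡ - (x - y)
  s = solve-∀

sgn-neg : ∀ c x → ∃[ d ] sgn d (- x) ≡ sgn c x
sgn-neg Fin.zero    x = Fin.suc Fin.zero , ℤP.neg-involutive x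
sgn-neg (Fin.suc _) x = Fin.zero , refl

-- The cycles v and −v and their translates: it suffices that v meets every class
-- {±r} modulo 2k+1, and that so do its differences.
module Starter (k : ℕ) (v : ℕ → ℤ) where
  open Residue (suc (2 ℕ.* k))

  private u = suc (2 ℕ.* k)

  halves : ∀ {x y} → x ≢ y → ∃[ r ] r < k × (⟦ + toℕ x + + suc r ⟧ ≡ y ⊎ ⟦ + toℕ x + - + suc r ⟧ ≡ y)
  halves {x} {y} x≢y with offset x≢y
  ... | r , s≤s r<2k , e with r ℕP.<? k
  ... | yes r<k = r , r<k , inj₁ e
  ... | no r≮k with q , eq ← ℕP.m≤n⇒∃[o]m+o≡n r<2k = q , q<k ,
    inj₂ (trans (⟦⟧-eq (- + 1) (by-linear (- + 1) (cong +_ eq) (s (+ toℕ x) (+ q) (+ r) (+ (2 ℕ.* k))))) e)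
    where
    q<k : q < k
    q<k = ℕP.+-cancelˡ-< k q k (subst (k ℕ.+ q <_) (trans eq (cong (k ℕ.+_) (ℕP.+-identityʳ k))) (s≤s (ℕP.+-monoˡ-≤ q (ℕP.≮⇒≥ r≮k))))
    s : ∀ x q r K → x + - (+ 1 + q) ≡ (x + (+ 1 + r) + (- + 1) * (+ 1 + K)) + (- + 1) * ((+ 1 + r + q) - K)
    s = solve-∀

  -- A residue and its negative are met by cycles of opposite sign. The values are asked for in ℤ
  -- but the differences only modulo `2k + 1`, because a sign change inside `v` produces differences
  -- exceeding `k` in absolute value.
  near-two :
    v k ≡ v 0 →
    (∀ {r} → r < k → ∃[ j ] ∃[ c ] j < k × sgn c (v j) ≡ + suc r) →
    (∀ {r} → r < k → ∃[ j ] ∃[ c ] j < k × ⟦ sgn c (v (suc j) - v j) ⟧ ≡ ⟦ + suc r ⟧) →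
    Near k 2 (Fin u)
  near-two v-closed values differences = record
    { cyc    = λ i c j → ⟦ + toℕ i + sgn c (v j) ⟧
    ; closed = λ i c → cong (λ z → ⟦ + toℕ i + sgn c z ⟧) v-closed
    ; find   = find
    ; edge   = edge
    }
    where
    find : ∀ i x → x ≢ i → ∃[ c ] ∃[ j ] j < k × ⟦ + toℕ i + sgn c (v j) ⟧ ≡ x
    find i x x≢i with halves (x≢i ∘ sym)
    ... | r , r<k , h with values r<k | h
    ... | j , c , j<k , e | inj₁ p = c , j , j<k , trans (cong (λ z → ⟦ + toℕ i + z ⟧) e) p
    ... | j , c , j<k , e | inj₂ p = flip c , j , j<k ,
      trans (cong (λ z → ⟦ + toℕ i + z ⟧) (trans (sgn-flip c (v j)) (cong -_ e))) p

    edge : ∀ x y → x ≢ y → ∃[ i ] ∃[ c ] ∃[ j ] j < k × ⟦ + toℕ i + sgn c (v j) ⟧ ≡ x × ⟦ + toℕ i + sgn c (v (suc j)) ⟧ ≡ y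
    edge x y x≢y with halves x≢y
    ... | r , r<k , h with differences r<k | h
    ... | j , c , j<k , e | inj₁ p = ⟦ + toℕ x - sgn c (v j) ⟧ , c , j , j<k , translate x (sgn c (v j)) ,
      translate-step x (sgn c (v j)) (sgn c (v (suc j))) (+ suc r) p (trans (cong ⟦_⟧ (sgn-- c (v (suc j)) (v j))) e)
    ... | j , c , j<k , e | inj₂ p = ⟦ + toℕ x - sgn (flip c) (v j) ⟧ , flip c , j , j<k , translate x (sgn (flip c) (v j)) ,
      translate-step x (sgn (flip c) (v j)) (sgn (flip c) (v (suc j))) (- + suc r) p
        (trans (cong ⟦_⟧ (trans (sgn-- (flip c) (v (suc j)) (v j)) (sgn-flip c (v (suc j) - v j)))) (⟦⟧-neg e))

-- v = 1, 2m, 2, 2m−1, …, m+1 with all signs changed from the term number 2r+2 on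
-- (here m = 2r+3).  The sign change turns the difference m+2 into ±2m, and the
-- closing edge supplies m+2.
near-two-odd : ∀ r → Near (suc (suc r ℕ.* 2) ℕ.* 2) 2 (Fin (suc (2 ℕ.* (suc (suc r ℕ.* 2) ℕ.* 2))))
near-two-odd r = near-two (close-end k w) values differences
  where
  m = suc (suc r ℕ.* 2)
  k = m ℕ.* 2
  a = suc (r ℕ.* 2)

  z : ℕ → ℤ
  z = zig (λ l → + suc l) (λ l → + k - + l)

  z-even : ∀ l → z (l ℕ.* 2) ≡ + suc l
  z-even = zig-even _ _

  z-odd : ∀ l → z (suc (l ℕ.* 2)) ≡ + k - + l
  z-odd = zig-odd (λ l → + suc l) _

  w : ℕ → ℤ
  w = glue a z (λ j → - z j)

  w-< : ∀ {j} → j < a → w j ≡ z j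
  w-< = glue-< z (λ j → - z j)

  w-≥ : ∀ {j} → a ≤ j → w j ≡ - z j
  w-≥ = glue-≥ z (λ j → - z j)

  v : ℕ → ℤ
  v = close k w

  open Starter k v
  open Residue (suc (2 ℕ.* k))

  v-sign : ∀ {j} → j < k → ∃[ c ] sgn c (v j) ≡ z j
  v-sign {j} j<k with j ℕP.<? a
  ... | yes j<a = Fin.zero , trans (close-< w j<k) (w-< j<a)
  ... | no j≮a  = Fin.suc Fin.zero ,
    trans (cong -_ (trans (close-< w j<k) (w-≥ (ℕP.≮⇒≥ j≮a)))) (ℤP.neg-involutive (z j))

  values : ∀ {q} → q < k → ∃[ j ] ∃[ c ] j < k × sgn c (v j) ≡ + suc q
  values {q} q<k with q ℕP.<? m
  ... | yes q<m with c , e ← v-sign (2l<2m q<m) = q ℕ.* 2 , c , 2l<2m q<m , trans e (z-even q)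
  ... | no q≮m with l , eq ← ℕP.m≤n⇒∃[o]m+o≡n q<k = suc (l ℕ.* 2) , proj₁ (v-sign j<k) , j<k ,
      trans (proj₂ (v-sign j<k)) (trans (z-odd l) (by-linear (- + 1) (cong +_ eq) (s (+ q) (+ l) (+ k))))
    where
    l<m : l < m
    l<m = ℕP.+-cancelˡ-< m l m (subst (m ℕ.+ l <_) (trans eq (*2-double m)) (s≤s (ℕP.+-monoˡ-≤ l (ℕP.≮⇒≥ q≮m))))
    j<k = 1+2l<2m l<m
    s : ∀ q l k → k - l ≡ (+ 1 + q) + (- + 1) * ((+ 1 + q + l) - k)
    s = solve-∀

  z-step : ∀ d j → d ℕ.+ suc j ≡ k → ∃[ c ] sgn c (z (suc j) - z j) ≡ + d
  z-step d j e with parity j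
  ... | even l = Fin.zero , trans (cong₂ _-_ (z-odd l) (z-even l))
    (by-linear (- + 1) (cong +_ (trans (cong (λ x → d ℕ.+ suc x) (sym (*2-double l))) e)) (s (+ d) (+ l) (+ k)))
    where
    s : ∀ d l k → (k - l) - (+ 1 + l) ≡ d + (- + 1) * ((d + (+ 1 + (l + l))) - k)
    s = solve-∀
  ... | odd l = Fin.suc Fin.zero , trans (cong -_ (cong₂ _-_ (z-even (suc l)) (z-odd l)))
    (by-linear (- + 1) (cong +_ (trans (cong (λ x → d ℕ.+ suc (suc x)) (sym (*2-double l))) e)) (s (+ d) (+ l) (+ k)))
    where
    s : ∀ d l k → - ((+ 2 + l) - (k - l)) ≡ d + (- + 1) * ((d + (+ 2 + (l + l))) - k)
    s = solve-∀

  differences : ∀ {q} → q < k → ∃[ j ] ∃[ c ] j < k × ⟦ sgn c (v (suc j) - v j) ⟧ ≡ ⟦ + suc q ⟧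
  differences {q} q<k with ℕP.m≤n⇒∃[o]m+o≡n q<k
  ... | zero , eq = r ℕ.* 2 , Fin.zero , ℕP.<-trans (ℕP.n<1+n _) a<k ,
    trans (cong ⟦_⟧ (cong₂ _-_ v₁ v₀)) (⟦⟧-eq (- + 1) (by-linear (- + 1) eqℤ (s (+ r) (+ k) (+ q))))
    where
    a<k : a < k
    a<k = 1+2l<2m (s≤s (ℕP.≤-trans (ℕP.m≤m*n r 2) (ℕP.m≤n+m _ 2)))
    v₁ : v a ≡ - (+ k - + r)
    v₁ = trans (close-< w a<k) (trans (w-≥ ℕP.≤-refl) (cong -_ (z-odd r)))
    v₀ : v (r ℕ.* 2) ≡ + suc r
    v₀ = trans (close-< w (ℕP.<-trans (ℕP.n<1+n _) a<k)) (trans (w-< (ℕP.n<1+n _)) (z-even r))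
    eqℤ : + 1 + + q ≡ + k
    eqℤ = cong +_ (trans (sym (ℕP.+-identityʳ (suc q))) eq)
    s : ∀ r k q → - (k - r) - (+ 1 + r) ≡ ((+ 1 + q) + (- + 1) * (+ 1 + (k + (k + + 0)))) + (- + 1) * ((+ 1 + q) - k)
    s = solve-∀
  -- In `z` the difference `suc q` occurs, up to sign, from time `j` to `j + 1`; the cases are steps
  -- before, at and after the sign change.
  ... | suc j , eq = go (ℕP.<-cmp j (r ℕ.* 2))
    where
    1+j<k : suc j < k
    1+j<k = subst (suc j <_) eq (s≤s (ℕP.m≤n+m (suc j) q))
    j<k = ℕP.<-trans (ℕP.n<1+n j) 1+j<k
    step : ∃[ c ] sgn c (z (suc j) - z j) ≡ + suc q
    step = z-step (suc q) j eq
    go : Tri (j < r ℕ.* 2) (j ≡ r ℕ.* 2) (r ℕ.* 2 < j) → ∃[ j ] ∃[ c ] j < k × ⟦ sgn c (v (suc j) - v j) ⟧ ≡ ⟦ + suc q ⟧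
    go (tri< j<2r _ _) = j , proj₁ step , j<k ,
      cong ⟦_⟧ (trans (cong (sgn (proj₁ step)) (cong₂ _-_ (trans (close-< w 1+j<k) (w-< (s≤s j<2r)))
                                                         (trans (close-< w j<k) (w-< (ℕP.m≤n⇒m≤1+n j<2r))))) (proj₂ step))
    go (tri> _ _ j>2r) with d , e ← sgn-neg (proj₁ step) (z (suc j) - z j) = j , d , j<k ,
      cong ⟦_⟧ (trans (cong (sgn d) (trans (cong₂ _-_ (trans (close-< w 1+j<k) (w-≥ (ℕP.m≤n⇒m≤1+n j>2r)))
                                                     (trans (close-< w j<k) (w-≥ j>2r))) (sgn-- (Fin.suc Fin.zero) (z (suc j)) (z j))))
               (trans e (proj₂ step)))
    -- Here `suc q` is `m + 2`, the difference lost to the sign change; the closing edge from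
    -- `-(m + 1)` to `1` restores it.
    go (tri≈ _ refl _) = suc (l ℕ.* 2) , Fin.zero , ℕP.≤-refl ,
      cong ⟦_⟧ (trans (cong₂ _-_ (close-end k w) last) (by-linear (- + 1) (cong +_ eq) (s (+ q) (+ (r ℕ.* 2)) (+ k))))
      where
      l = suc r ℕ.* 2
      last : v (suc (l ℕ.* 2)) ≡ - (+ k - + l)
      last = trans (close-< {k = k} {j = suc (l ℕ.* 2)} w ℕP.≤-refl) (trans (w-≥ (s≤s (ℕP.≤-trans (ℕP.m≤n+m (r ℕ.* 2) 2) (ℕP.m≤m*n l 2)))) (cong -_ (z-odd l)))
      s : ∀ q R k → + 1 - - (k - (+ 2 + R)) ≡ (+ 1 + q) + (- + 1) * ((+ 1 + q + (+ 1 + R)) - k)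
      s = solve-∀

-- With m = 2R: v = R, 3R, R+1, 3R−1, …, 2R, with differences m, …, 1, followed by
-- −4R, −1, −(4R−1), −2, …, −(3R+1), with differences 4R−1, …, 2R+2; the two
-- connecting edges supply 2R+1 and 4R.
near-two-even : ∀ r → Near ((suc r ℕ.* 2) ℕ.* 2) 2 (Fin (suc (2 ℕ.* ((suc r ℕ.* 2) ℕ.* 2))))
near-two-even r = near-two (close-end k w) values differences
  where
  R = suc r
  m = R ℕ.* 2
  k = m ℕ.* 2

  m≡ : m ≡ R ℕ.+ R
  m≡ = *2-double R

  k≡ : k ≡ m ℕ.+ m
  k≡ = *2-double m

  z₁ z₂ : ℕ → ℤ
  z₁ = zig (λ l → + R + + l) (λ l → + (R ℕ.+ R ℕ.+ R) - + l)
  z₂ = zig (λ l → - (+ k - + l)) (λ l → - + suc l)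

  z₁-even : ∀ l → z₁ (l ℕ.* 2) ≡ + R + + l
  z₁-even = zig-even (λ l → + R + + l) (λ l → + (R ℕ.+ R ℕ.+ R) - + l)

  z₁-odd : ∀ l → z₁ (suc (l ℕ.* 2)) ≡ + (R ℕ.+ R ℕ.+ R) - + l
  z₁-odd = zig-odd (λ l → + R + + l) (λ l → + (R ℕ.+ R ℕ.+ R) - + l)

  z₂-even : ∀ l → z₂ (l ℕ.* 2) ≡ - (+ k - + l)
  z₂-even = zig-even (λ l → - (+ k - + l)) (λ l → - + suc l)

  z₂-odd : ∀ l → z₂ (suc (l ℕ.* 2)) ≡ - + suc l
  z₂-odd = zig-odd (λ l → - (+ k - + l)) (λ l → - + suc l)

  w : ℕ → ℤ
  w = glue (suc m) z₁ (λ j → z₂ (j ℕ.∸ suc m))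

  v : ℕ → ℤ
  v = close k w

  m<k : m < k
  m<k = subst (m <_) (sym k≡) (ℕP.m<m+n m (s≤s z≤n))

  v-first : ∀ {j} → j ≤ m → v j ≡ z₁ j
  v-first j≤m = trans (close-< w (ℕP.≤-<-trans j≤m m<k)) (glue-< z₁ (λ j → z₂ (j ℕ.∸ suc m)) (s≤s j≤m))

  v-second : ∀ {i} → suc m ℕ.+ i < k → v (suc m ℕ.+ i) ≡ z₂ i
  v-second {i} j<k = trans (close-< w j<k)
    (trans (glue-≥ z₁ (λ j → z₂ (j ℕ.∸ suc m)) (ℕP.m≤m+n (suc m) i)) (cong z₂ (ℕP.m+n∸m≡n (suc m) i)))

  open Starter k v
  open Residue (suc (2 ℕ.* k))

  second<k : ∀ {i} → suc i < m → suc m ℕ.+ i < k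
  second<k {i} i<m = subst₂ _<_ (ℕP.+-suc m i) (sym k≡) (ℕP.+-monoʳ-< m i<m)

  values : ∀ {q} → q < k → ∃[ j ] ∃[ c ] j < k × sgn c (v j) ≡ + suc q
  -- The values up to `R - 1`, `2R`, `3R` and `4R` are met in turn by the odd-numbered terms of
  -- `z₂`, the even-numbered and odd-numbered terms of `z₁`, and the even-numbered terms of `z₂`.
  values {q} q<k with q ℕP.<? r
  ... | yes q<r = suc m ℕ.+ suc (q ℕ.* 2) , Fin.suc Fin.zero , j<k ,
    trans (cong -_ (trans (v-second j<k) (z₂-odd q))) (ℤP.neg-involutive (+ suc q))
    where j<k = second<k (s≤s (s≤s (2l<2m q<r)))
  ... | no q≮r with q ℕP.<? R ℕ.+ R
  ... | yes q<2R with l , eq ← ℕP.m≤n⇒∃[o]m+o≡n (s≤s (ℕP.≮⇒≥ q≮r)) =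
    l ℕ.* 2 , Fin.zero , ℕP.≤-<-trans j≤m m<k , trans (v-first j≤m) (trans (z₁-even l) (cong +_ eq))
    where
    j≤m : l ℕ.* 2 ≤ m
    j≤m = ℕP.*-monoˡ-≤ 2 (ℕP.+-cancelˡ-≤ R l R (subst (_≤ R ℕ.+ R) (sym eq) q<2R))
  ... | no q≮2R with q ℕP.<? R ℕ.+ R ℕ.+ R
  ... | yes q<3R with l , eq ← ℕP.m≤n⇒∃[o]m+o≡n q<3R =
    suc (l ℕ.* 2) , Fin.zero , ℕP.<-trans j<m m<k ,
    trans (v-first (ℕP.<⇒≤ j<m)) (trans (z₁-odd l) (by-linear (- + 1) (cong +_ eq) (s (+ q) (+ l) (+ (R ℕ.+ R ℕ.+ R)))))
    where
    j<m : suc (l ℕ.* 2) < m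
    j<m = 1+2l<2m (ℕP.+-cancelˡ-< (R ℕ.+ R) l R (subst (R ℕ.+ R ℕ.+ l <_) eq (s≤s (ℕP.+-monoˡ-≤ l (ℕP.≮⇒≥ q≮2R)))))
    s : ∀ q l K → K - l ≡ (+ 1 + q) + (- + 1) * ((+ 1 + q + l) - K)
    s = solve-∀
  ... | no q≮3R with l , eq ← ℕP.m≤n⇒∃[o]m+o≡n q<k =
    suc m ℕ.+ l ℕ.* 2 , Fin.suc Fin.zero , j<k ,
    trans (cong -_ (trans (v-second j<k) (z₂-even l))) (by-linear (- + 1) (cong +_ eq) (s (+ q) (+ l) (+ k)))
    where
    4R : k ≡ R ℕ.+ R ℕ.+ R ℕ.+ R
    4R = trans k≡ (trans (cong₂ ℕ._+_ m≡ m≡) (sym (ℕP.+-assoc (R ℕ.+ R) R R)))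
    j<k : suc m ℕ.+ l ℕ.* 2 < k
    j<k = second<k (1+2l<2m (ℕP.+-cancelˡ-< (R ℕ.+ R ℕ.+ R) l R
      (subst (R ℕ.+ R ℕ.+ R ℕ.+ l <_) (trans eq 4R) (s≤s (ℕP.+-monoˡ-≤ l (ℕP.≮⇒≥ q≮3R))))))
    s : ∀ q l K → - - (K - l) ≡ (+ 1 + q) + (- + 1) * ((+ 1 + q + l) - K)
    s = solve-∀

  z₁-step : ∀ d j → d ℕ.+ j ≡ m → ∃[ c ] sgn c (z₁ (suc j) - z₁ j) ≡ + d
  z₁-step d j e with parity j
  ... | even l = Fin.zero , trans (cong₂ _-_ (z₁-odd l) (z₁-even l))
    (by-linear (- + 1) (cong +_ (trans (cong (d ℕ.+_) (sym (*2-double l))) (trans e m≡))) (s (+ d) (+ l) (+ R)))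
    where
    s : ∀ d l R → (R + R + R - l) - (R + l) ≡ d + (- + 1) * ((d + (l + l)) - (R + R))
    s = solve-∀
  ... | odd l = Fin.suc Fin.zero , trans (cong -_ (cong₂ _-_ (z₁-even (suc l)) (z₁-odd l)))
    (by-linear (- + 1) (cong +_ (trans (cong (λ x → d ℕ.+ suc x) (sym (*2-double l))) (trans e m≡))) (s (+ d) (+ l) (+ R)))
    where
    s : ∀ d l R → - ((R + (+ 1 + l)) - (R + R + R - l)) ≡ d + (- + 1) * ((d + (+ 1 + (l + l))) - (R + R))
    s = solve-∀

  z₂-step : ∀ d i → d ℕ.+ suc i ≡ k → ∃[ c ] sgn c (z₂ (suc i) - z₂ i) ≡ + d
  z₂-step d i e with parity i
  ... | even l = Fin.zero , trans (cong₂ _-_ (z₂-odd l) (z₂-even l))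
    (by-linear (- + 1) (cong +_ (trans (cong (λ x → d ℕ.+ suc x) (sym (*2-double l))) e)) (s (+ d) (+ l) (+ k)))
    where
    s : ∀ d l K → - (+ 1 + l) - - (K - l) ≡ d + (- + 1) * ((d + (+ 1 + (l + l))) - K)
    s = solve-∀
  ... | odd l = Fin.suc Fin.zero , trans (cong -_ (cong₂ _-_ (z₂-even (suc l)) (z₂-odd l)))
    (by-linear (- + 1) (cong +_ (trans (cong (λ x → d ℕ.+ suc (suc x)) (sym (*2-double l))) e)) (s (+ d) (+ l) (+ k)))
    where
    s : ∀ d l K → - (- (K - (+ 1 + l)) - - (+ 1 + l)) ≡ d + (- + 1) * ((d + (+ 2 + (l + l))) - K)
    s = solve-∀

  differences : ∀ {q} → q < k → ∃[ j ] ∃[ c ] j < k × ⟦ sgn c (v (suc j) - v j) ⟧ ≡ ⟦ + suc q ⟧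
  differences {q} q<k with ℕP.<-cmp q m
  ... | tri< q<m _ _ with j , eq ← ℕP.m≤n⇒∃[o]m+o≡n q<m with c , e ← z₁-step (suc q) j eq =
    j , c , ℕP.<-trans j<m m<k , cong ⟦_⟧ (trans (cong (sgn c) (cong₂ _-_ (v-first j<m) (v-first (ℕP.<⇒≤ j<m)))) e)
    where
    j<m : j < m
    j<m = subst (j <_) eq (s≤s (ℕP.m≤n+m j q))
  -- The edge from `2R` to `-4R` has difference `-(k + m)`, which is `m + 1` modulo `2k + 1` because
  -- `k` is `m + m`.
  ... | tri≈ _ refl _ = m , Fin.zero , m<k , (begin
    ⟦ v (suc m) - v m ⟧              ≡⟨ cong ⟦_⟧ (cong₂ _-_ v-next (trans (v-first ℕP.≤-refl) (z₁-even R))) ⟩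
    ⟦ - (+ k - + 0) - (+ R + + R) ⟧  ≡⟨ ⟦⟧-eq (- + 1) (by-linear (- + 1) eqℤ (s (+ k) (+ m) (+ R))) ⟩
    ⟦ + suc m ⟧                      ∎)
    where
    open ≡-Reasoning
    1+m<k = second<k {0} (s≤s (s≤s z≤n))
    v-next : v (suc m) ≡ - (+ k - + 0)
    v-next = trans (cong v (sym (ℕP.+-identityʳ (suc m)))) (v-second 1+m<k)
    eqℤ : (+ m + + m) + (+ R + + R) ≡ + k + + m
    eqℤ = cong +_ (cong₂ ℕ._+_ (sym k≡) (sym m≡))
    s : ∀ k m R → - (k - + 0) - (R + R) ≡ ((+ 1 + m) + (- + 1) * (+ 1 + (k + (k + + 0)))) + (- + 1) * (((m + m) + (R + R)) - (k + m))
    s = solve-∀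
  ... | tri> _ _ q>m with ℕP.m≤n⇒∃[o]m+o≡n q<k
  -- The closing edge has difference `k + 1`, whose negative is `k` modulo `2k + 1`.
  ... | zero , eq = suc m ℕ.+ r ℕ.* 2 , Fin.suc Fin.zero , j<k , (begin
    ⟦ - (v (suc (suc m ℕ.+ r ℕ.* 2)) - v (suc m ℕ.+ r ℕ.* 2)) ⟧
      ≡⟨ cong ⟦_⟧ (cong -_ (cong₂ _-_ (trans (cong v 1+j≡k) (close-end k w)) (trans (v-second j<k) (z₂-even r)))) ⟩
    ⟦ - (+ suc r + + 0 - - (+ k - + r)) ⟧
      ≡⟨ ⟦⟧-eq (- + 1) (by-linear (- + 1) eqℤ (s (+ k) (+ q) (+ r))) ⟩
    ⟦ + suc q ⟧ ∎)
    where
    open ≡-Reasoning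
    j<k = second<k {r ℕ.* 2} ℕP.≤-refl
    1+j≡k : suc (suc m ℕ.+ r ℕ.* 2) ≡ k
    1+j≡k = trans (sym (trans (ℕP.+-suc m (suc (r ℕ.* 2))) (cong suc (ℕP.+-suc m (r ℕ.* 2))))) (sym k≡)
    eqℤ : + 1 + + q ≡ + k
    eqℤ = cong +_ (trans (sym (ℕP.+-identityʳ (suc q))) eq)
    s : ∀ k q r → - ((+ 1 + r) + + 0 - - (k - r)) ≡ ((+ 1 + q) + (- + 1) * (+ 1 + (k + (k + + 0)))) + (- + 1) * ((+ 1 + q) - k)
    s = solve-∀
  ... | suc i , eq with c , e ← z₂-step (suc q) i eq = suc m ℕ.+ i , c , j<k ,
    cong ⟦_⟧ (trans (cong (sgn c) (cong₂ _-_ (trans (cong v (sym (ℕP.+-suc (suc m) i))) (v-second 1+j<k)) (v-second j<k))) e)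
    where
    1+j<k : suc m ℕ.+ suc i < k
    1+j<k = subst (suc m ℕ.+ suc i <_) eq (ℕP.+-monoˡ-< (suc i) (s≤s q>m))
    j<k : suc m ℕ.+ i < k
    j<k = ℕP.<-trans (ℕP.+-monoʳ-< (suc m) (ℕP.n<1+n i)) 1+j<k

-- Products

near-↔ : ∀ {k t} → V ↔ W → Near k t V → Near k t W
near-↔ V↔W N = record
  { cyc    = λ i c j → to (cyc (from i) c j)
  ; closed = λ i c → cong to (closed (from i) c)
  ; find   = λ i x x≢i →
      let c , j , j<k , e = find (from i) (from x) (x≢i ∘ from-injective)
      in c , j , j<k , trans (cong to e) (strictlyInverseˡ x)
  ; edge   = λ x y x≢y →
      let i , c , j , j<k , e , e′ = edge (from x) (from y) (x≢y ∘ from-injective)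
          at = cong (λ i′ → cyc i′ c) (strictlyInverseʳ i)
      in to i , c , j , j<k , trans (cong to (trans (cong (λ f → f j) at) e)) (strictlyInverseˡ x)
                            , trans (cong to (trans (cong (λ f → f (suc j)) at) e′)) (strictlyInverseˡ y)
  }
  where
  open Near N
  open Inverse V↔W using (to; from; strictlyInverseˡ; strictlyInverseʳ)
  from-injective : ∀ {x y} → from x ≡ from y → x ≡ y
  from-injective e = trans (sym (strictlyInverseˡ _)) (trans (cong to e) (strictlyInverseˡ _))

Maybe↔Fin : ∀ {n} → V ↔ Fin n → Maybe V ↔ Fin (suc n)
Maybe↔Fin V↔Fin = mk↔ₛ′ f g fg gf
  where
  open Inverse V↔Fin using (to; from; strictlyInverseˡ; strictlyInverseʳ)
  f : _ → _
  f nothing  = Fin.zero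
  f (just x) = Fin.suc (to x)
  g : _ → _
  g Fin.zero    = nothing
  g (Fin.suc i) = just (from i)
  fg : ∀ i → f (g i) ≡ i
  fg Fin.zero    = refl
  fg (Fin.suc i) = cong Fin.suc (strictlyInverseˡ i)
  gf : ∀ x → g (f x) ≡ x
  gf nothing  = refl
  gf (just x) = cong just (strictlyInverseʳ x)

-- Frames

-- A 1-frame of type 2ⁿ⁺¹: for each group b two perfect matchings of the points
-- outside b, such that any two points of distinct groups are matched once.
record Frame (n : ℕ) : Set where
  field
    pair    : Fin (suc n) → Fin 2 → Fin n → Fin 2 → Fin (suc n) × Fin 2
    matched : ∀ b ε x η → x ≢ b → ∃[ s ] ∃[ e ] pair b ε s e ≡ (x , η)
    join    : ∀ x η y θ → x ≢ y → ∃[ b ] ∃[ ε ] ∃[ s ] ∃[ e ] pair b ε s e ≡ (x , η) × pair b ε s (flip e) ≡ (y , θ)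

-- The starter {1,2}, {3,6}, {5,7} in ℤ/8, with groups the cosets of {0,4}.
frame-four : Frame 3
frame-four = record
  { pair    = pair
  ; matched = toWitness {a? = FinP.all? λ b → FinP.all? λ ε → FinP.all? λ x → FinP.all? λ η → ¬? (x Fin.≟ b) →-dec
              (FinP.any? λ s → FinP.any? λ e → pair b ε s e ≟ (x , η))} _
  ; join    = toWitness {a? = FinP.all? λ x → FinP.all? λ η → FinP.all? λ y → FinP.all? λ θ → ¬? (x Fin.≟ y) →-dec
              (FinP.any? λ b → FinP.any? λ ε → FinP.any? λ s → FinP.any? λ e →
                (pair b ε s e ≟ (x , η)) ×-dec (pair b ε s (flip e) ≟ (y , θ)))} _
  }
  where
  _≟_ = ProdP.≡-dec {A = Fin 4} {B = λ _ → Fin 2} Fin._≟_ Fin._≟_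
  starter : Fin 3 → Fin 2 → ℕ
  starter Fin.zero                     Fin.zero    = 1
  starter Fin.zero                     (Fin.suc _) = 2
  starter (Fin.suc Fin.zero)           Fin.zero    = 3
  starter (Fin.suc Fin.zero)           (Fin.suc _) = 6
  starter (Fin.suc (Fin.suc Fin.zero)) Fin.zero    = 5
  starter (Fin.suc (Fin.suc Fin.zero)) (Fin.suc _) = 7
  pair : Fin 4 → Fin 2 → Fin 3 → Fin 2 → Fin 4 × Fin 2
  -- The element `x` of ℤ/8 stands for the point `(x mod 4 , x div 4)`. The two matchings missing
  -- the group `b` are the translates of the starter by its two elements `b` and `b + 4`.
  pair b ε s e = swap (remQuot 4 ((toℕ b ℕ.+ 4 ℕ.* toℕ ε ℕ.+ starter s e) mod 8))

_⊕_ : Fin 2 → Fin 2 → Fin 2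
Fin.zero    ⊕ y = y
(Fin.suc _) ⊕ y = flip y

⊕-cancel : ∀ x y → (x ⊕ y) ⊕ y ≡ x
⊕-cancel Fin.zero Fin.zero = refl
⊕-cancel Fin.zero (Fin.suc Fin.zero) = refl
⊕-cancel (Fin.suc Fin.zero) Fin.zero = refl
⊕-cancel (Fin.suc Fin.zero) (Fin.suc Fin.zero) = refl

⊕-cancel′ : ∀ x y → y ⊕ (x ⊕ y) ≡ x
⊕-cancel′ Fin.zero Fin.zero = refl
⊕-cancel′ Fin.zero (Fin.suc Fin.zero) = refl
⊕-cancel′ (Fin.suc Fin.zero) Fin.zero = refl
⊕-cancel′ (Fin.suc Fin.zero) (Fin.suc Fin.zero) = refl

-- The matching `(b , ε)` joins `(x , α)` to `(2b - x , α ⊕ ε)`, where `⊕` is addition modulo 2. As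
-- the number of groups is odd, two distinct groups have a midpoint `b`, and `ε` is the sum of the
-- two labels.
frame-odd : ∀ h → Frame (h ℕ.* 2)
frame-odd h = record { pair = pair ; matched = matched ; join = join }
  where
  n = suc (h ℕ.* 2)
  open Residue n

  ends : Fin n → Fin 2 → Fin h × Fin 2 → Fin 2 → Fin n × Fin 2
  ends b ε (l , α) Fin.zero    = ⟦ + toℕ b + + suc (toℕ l) ⟧ , α
  ends b ε (l , α) (Fin.suc _) = ⟦ + toℕ b + - + suc (toℕ l) ⟧ , α ⊕ ε

  pair : Fin n → Fin 2 → Fin (h ℕ.* 2) → Fin 2 → Fin n × Fin 2
  pair b ε s = ends b ε (remQuot 2 s)

  pair-combine : ∀ b ε l α e → pair b ε (combine l α) e ≡ ends b ε (l , α) e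
  pair-combine b ε l α e = cong (λ s → ends b ε s e) (FinP.remQuot-combine l α)

  at⁺ : ∀ b ε {l α x} (l<h : l < h) → ⟦ + toℕ b + + suc l ⟧ ≡ x → pair b ε (combine (fromℕ< l<h) α) Fin.zero ≡ (x , α)
  at⁺ b ε {l} {α} l<h e = trans (pair-combine b ε (fromℕ< l<h) α Fin.zero)
    (cong (_, α) (trans (cong (λ l → ⟦ + toℕ b + + suc l ⟧) (FinP.toℕ-fromℕ< l<h)) e))

  at⁻ : ∀ b ε {l α x} (l<h : l < h) → ⟦ + toℕ b + - + suc l ⟧ ≡ x →
        pair b ε (combine (fromℕ< l<h) α) (Fin.suc Fin.zero) ≡ (x , α ⊕ ε)
  at⁻ b ε {l} {α} l<h e = trans (pair-combine b ε (fromℕ< l<h) α (Fin.suc Fin.zero))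
    (cong (_, α ⊕ ε) (trans (cong (λ l → ⟦ + toℕ b + - + suc l ⟧) (FinP.toℕ-fromℕ< l<h)) e))

  matched : ∀ b ε x η → x ≢ b → ∃[ s ] ∃[ e ] pair b ε s e ≡ (x , η)
  matched b ε x η x≢b with offset (x≢b ∘ sym)
  ... | r , s≤s r<2h , e with r ℕP.<? h
  ... | yes r<h = combine (fromℕ< r<h) η , Fin.zero , at⁺ b ε r<h e
  ... | no r≮h with l , eq ← ℕP.m≤n⇒∃[o]m+o≡n r<2h = combine (fromℕ< l<h) (η ⊕ ε) , Fin.suc Fin.zero ,
    trans (at⁻ b ε l<h (trans (⟦⟧-eq (- + 1) (by-linear (- + 1) (cong +_ eq) (s (+ toℕ b) (+ l) (+ r) (+ (h ℕ.* 2))))) e))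
          (cong (x ,_) (⊕-cancel η ε))
    where
    l<h : l < h
    l<h = ℕP.+-cancelˡ-< h l h (subst (h ℕ.+ l <_) (trans eq (*2-double h)) (s≤s (ℕP.+-monoˡ-≤ l (ℕP.≮⇒≥ r≮h))))
    s : ∀ b l r H → b + - (+ 1 + l) ≡ (b + (+ 1 + r) + (- + 1) * (+ 1 + H)) + (- + 1) * ((+ 1 + r + l) - H)
    s = solve-∀

  -- One of y − x and x − y has an even representative 2 (1 + l) < n, and the
  -- middle of the corresponding arc is the hole.
  mid : ∀ {x y l} → l < h → ⟦ + toℕ x + + (suc l ℕ.* 2) ⟧ ≡ y →
        ∀ η θ → ∃[ b ] ∃[ ε ] ∃[ s ] pair b ε s Fin.zero ≡ (y , θ) × pair b ε s (Fin.suc Fin.zero) ≡ (x , η)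
  mid {x} {y} {l} l<h e η θ = b , η ⊕ θ , combine (fromℕ< l<h) θ ,
    at⁺ b (η ⊕ θ) l<h (translate-step x a (+ suc l) (+ (suc l ℕ.* 2)) e
      (cong ⟦_⟧ (trans (s (+ l)) (cong (λ x → + (2 ℕ.+ x)) (sym (*2-double l)))))) ,
    trans (at⁻ b (η ⊕ θ) l<h (translate x a)) (cong (x ,_) (⊕-cancel′ η θ))
    where
    a = - + suc l
    b = ⟦ + toℕ x - a ⟧
    s : ∀ l → (+ 1 + l) - - (+ 1 + l) ≡ + 2 + (l + l)
    s = solve-∀

  -- Since `n` is odd, an odd difference `2l + 1` from `x` to `y` becomes the even difference
  -- `n - (2l + 1)` from `y` to `x`.
  back : ∀ {x y} l o → suc l ℕ.+ o ≡ h → ⟦ + toℕ x + + suc (l ℕ.* 2) ⟧ ≡ y → ⟦ + toℕ y + + (suc o ℕ.* 2) ⟧ ≡ x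
  back {x} {y} l o eq e = begin
    ⟦ + toℕ y + + (suc o ℕ.* 2) ⟧
      ≡⟨ ⟦⟧-+ʳ (+ (suc o ℕ.* 2)) (trans (⟦⟧-toℕ y) (sym e)) ⟩
    ⟦ (+ toℕ x + + suc (l ℕ.* 2)) + + (suc o ℕ.* 2) ⟧
      ≡⟨ cong₂ (λ l o → ⟦ (+ toℕ x + + suc l) + + (2 ℕ.+ o) ⟧) (*2-double l) (*2-double o) ⟩
    ⟦ (+ toℕ x + + suc (l ℕ.+ l)) + + (2 ℕ.+ (o ℕ.+ o)) ⟧
      ≡⟨ ⟦⟧-eq (+ 1) (trans (s (+ toℕ x) (+ l) (+ o)) (cong (λ N → + toℕ x + + 1 * N) N≡)) ⟩
    ⟦ + toℕ x ⟧
      ≡⟨ ⟦⟧-toℕ x ⟩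
    x ∎
    where
    open ≡-Reasoning
    s : ∀ x l o → (x + (+ 1 + (l + l))) + (+ 2 + (o + o)) ≡ x + + 1 * (+ 1 + ((+ 1 + l + o) + (+ 1 + l + o)))
    s = solve-∀
    N≡ : + 1 + ((+ 1 + + l + + o) + (+ 1 + + l + + o)) ≡ + n
    N≡ = cong (λ x → + suc x) (trans (cong₂ ℕ._+_ eq eq) (sym (*2-double h)))

  join : ∀ x η y θ → x ≢ y → ∃[ b ] ∃[ ε ] ∃[ s ] ∃[ e ] pair b ε s e ≡ (x , η) × pair b ε s (flip e) ≡ (y , θ)
  join x η y θ x≢y with offset x≢y
  ... | r , s≤s r<2h , e with parity r
  ... | odd l =
    let b , ε , s , p , q = mid {x} {y} {l} (ℕP.*-cancelʳ-≤ (suc l) h 2 r<2h) e η θ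
    in b , ε , s , Fin.suc Fin.zero , q , p
  ... | even l =
    let o , eq = ℕP.m≤n⇒∃[o]m+o≡n (ℕP.*-cancelʳ-< 2 l h r<2h)
        b , ε , s , p , q = mid {y} {x} {o} (subst (o <_) eq (s≤s (ℕP.m≤n+m o l))) (back l o eq e) θ η
    in b , ε , s , Fin.zero , p , q

-- The product construction

module Product {n w′ m′ : ℕ} (F : Frame n) where
  w = suc w′
  m = suc m′
  open Frame F
  private
    module W = Residue w
    module M = Residue m

  -- Every frame point `(b , η)` is blown up into `w` blocks of `m` points. A group together with ∞,
  -- which is `nothing`, then has `1 + w * (m * 2)` points, as many as the given factorisation
  -- needs.
  X : Set
  X = Fin w × (Fin m × Fin 2)

  Blocks : Set
  Blocks = Maybe (Fin (suc n) × X)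

  at : Fin (suc n) × Fin 2 → Fin w → Fin m → Blocks
  at (b , η) y z = just (b , (y , (z , η)))

  at-cong : ∀ {P P′ y y′ z z′} → P ≡ P′ → y ≡ y′ → z ≡ z′ → at P y z ≡ at P′ y′ z′
  at-cong refl refl refl = refl

  up : Fin (suc n) → Maybe X → Blocks
  up b = Maybe.map (b ,_)

  -- Blocks P and Q are joined by the steps + z and − z − 1, hence in 2m steps the
  -- walk runs through both.
  cross : (P Q : Fin (suc n) × Fin 2) → Fin w → Fin w → Fin m → ℕ → Blocks
  cross P Q q y z = zig (λ l → at P q M.⟦ + 0 - + l ⟧) (λ l → at Q W.⟦ + toℕ q + + toℕ y ⟧ M.⟦ + toℕ z - + l ⟧)

  cross-even : ∀ P Q q y z l → cross P Q q y z (l ℕ.* 2) ≡ at P q M.⟦ + 0 - + l ⟧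
  cross-even P Q q y z = zig-even (λ l → at P q M.⟦ + 0 - + l ⟧) _

  cross-odd : ∀ P Q q y z l → cross P Q q y z (suc (l ℕ.* 2)) ≡ at Q W.⟦ + toℕ q + + toℕ y ⟧ M.⟦ + toℕ z - + l ⟧
  cross-odd P Q q y z = zig-odd (λ l → at P q M.⟦ + 0 - + l ⟧) _

  cross-closed : ∀ P Q q y z → cross P Q q y z (m ℕ.* 2) ≡ cross P Q q y z 0
  cross-closed P Q q y z = trans (cross-even P Q q y z m) (cong (at P q) (M.⟦⟧-eq (- + 1) (s (+ m))))
    where
    s : ∀ m → + 0 - m ≡ + 0 + (- + 1) * m
    s = solve-∀

  module _ (N : Near (m ℕ.* 2) w (Maybe X)) where
    private module N = Near N

    k′ = m ℕ.* 2

    -- Around ∞ each group carries a copy of the given factorisation. Around another hole the first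
    -- `w` cycles are the copy in its own group, and the other `n * w` run between blocks matched by
    -- `(b , ε)`; the coordinates `y` and `z` of the hole select the shift of block indices and the
    -- Hamiltonian cycle.
    cyc : Blocks → Fin (suc n ℕ.* w) → ℕ → Blocks
    cyc nothing c j = let b , q = remQuot w c in up b (N.cyc nothing q j)
    cyc (just (b , x@(y , (z , ε)))) c j =
      [ (λ q → up b (N.cyc (just x) q j))
      , (λ c → let s , q = remQuot w c in cross (pair b ε s Fin.zero) (pair b ε s (Fin.suc Fin.zero)) q y z j)
      ]′ (splitAt w c)

    closed : ∀ i c → cyc i c k′ ≡ cyc i c 0
    closed nothing c = cong (up _) (N.closed nothing _)
    closed (just (b , x@(y , (z , ε)))) c with splitAt w c
    ... | inj₁ q = cong (up b) (N.closed (just x) q)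
    ... | inj₂ c′ = let s , q = remQuot w c′ in cross-closed (pair b ε s Fin.zero) (pair b ε s (Fin.suc Fin.zero)) q y z

    cyc-up : ∀ b i q → ∃[ c ] ∀ j → cyc (up b i) c j ≡ up b (N.cyc i q j)
    cyc-up b nothing  q = combine b q , λ j → cong (λ (b , q) → up b (N.cyc nothing q j)) (FinP.remQuot-combine b q)
    cyc-up b (just x) q = q ↑ˡ (n ℕ.* w) , λ j → cong [ (λ q → up b (N.cyc (just x) q j)) , _ ]′ (FinP.splitAt-↑ˡ w q (n ℕ.* w))

    cyc-cross : ∀ b ε s q y z → ∃[ c ] ∀ j →
      cyc (just (b , (y , (z , ε)))) c j ≡ cross (pair b ε s Fin.zero) (pair b ε s (Fin.suc Fin.zero)) q y z j
    cyc-cross b ε s q y z = w ↑ʳ combine s q , λ j → trans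
      (cong [ _ , (λ c → let s , q = remQuot w c in cross (pair b ε s Fin.zero) (pair b ε s (Fin.suc Fin.zero)) q y z j) ]′
        (FinP.splitAt-↑ʳ w (n ℕ.* w) (combine s q)))
      (cong (λ (s , q) → cross (pair b ε s Fin.zero) (pair b ε s (Fin.suc Fin.zero)) q y z j) (FinP.remQuot-combine s q))

    find-up : ∀ b i x → up b x ≢ up b i → ∃[ c ] ∃[ j ] j < k′ × cyc (up b i) c j ≡ up b x
    find-up b i x x≢i =
      let q , j , j<k , e = N.find i x (x≢i ∘ cong (up b))
          c , ec = cyc-up b i q
      in c , j , j<k , trans (ec j) (cong (up b) e)

    find : ∀ i x → x ≢ i → ∃[ c ] ∃[ j ] j < k′ × cyc i c j ≡ x
    find nothing nothing x≢i = contradiction refl x≢i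
    find nothing (just (b , x)) x≢i = find-up b nothing (just x) x≢i
    find (just (b , x)) nothing x≢i = find-up b (just x) nothing x≢i
    find (just (b , i@(y , (z , ε)))) (just (b′ , x@(y′ , (z′ , η)))) x≢i with b′ Fin.≟ b
    ... | yes refl = find-up b (just i) (just x) x≢i
    ... | no b′≢b with matched b ε b′ η b′≢b
    ... | s , Fin.zero , e =
      let l , l<m , el = M.reach (+ 0) z′
          c , ec = cyc-cross b ε s y′ y z
      in c , l ℕ.* 2 , 2l<2m l<m ,
         trans (ec (l ℕ.* 2)) (trans (cross-even _ _ y′ y z l) (at-cong e refl el))
    ... | s , Fin.suc Fin.zero , e =
      let l , l<m , el = M.reach (+ toℕ z) z′
          -- Blocks at the second end have index `q + y`, so `q` is `y′ - y`.
          q = W.⟦ + toℕ y′ - + toℕ y ⟧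
          c , ec = cyc-cross b ε s q y z
      in c , suc (l ℕ.* 2) , 1+2l<2m l<m ,
         trans (ec (suc (l ℕ.* 2))) (trans (cross-odd _ _ q y z l)
           (at-cong e (W.translate y′ (+ toℕ y)) el))

    edge-up : ∀ b x y → up b x ≢ up b y → ∃[ i ] ∃[ c ] ∃[ j ] j < k′ × cyc i c j ≡ up b x × cyc i c (suc j) ≡ up b y
    edge-up b x y x≢y =
      let i , q , j , j<k , ex , ey = N.edge x y (x≢y ∘ cong (up b))
          c , ec = cyc-up b i q
      in up b i , c , j , j<k , trans (ec j) (cong (up b) ex) , trans (ec (suc j)) (cong (up b) ey)

    edge : ∀ x y → x ≢ y → ∃[ i ] ∃[ c ] ∃[ j ] j < k′ × cyc i c j ≡ x × cyc i c (suc j) ≡ y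
    edge nothing nothing x≢y = contradiction refl x≢y
    edge nothing (just (b , y)) x≢y = edge-up b nothing (just y) x≢y
    edge (just (b , x)) nothing x≢y = edge-up b (just x) nothing x≢y
    edge (just (b₁ , x@(y₁ , (z₁ , η)))) (just (b₂ , y@(y₂ , (z₂ , θ)))) x≢y with b₁ Fin.≟ b₂
    ... | yes refl = edge-up b₁ (just x) (just y) x≢y
    ... | no b₁≢b₂ with join b₁ η b₂ θ b₁≢b₂
    -- The frame determines `b` and `ε`, the block indices determine `y`; at time `2l` the walk is
    -- at `z₁`, and `z` is then chosen so that the next point is `z₂`.
    ... | b , ε , s , Fin.zero , e₁ , e₂ =
      let l , l<m , el = M.reach (+ 0) z₁
          y = W.⟦ + toℕ y₂ - + toℕ y₁ ⟧
          z = M.⟦ + toℕ z₂ - - + l ⟧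
          c , ec = cyc-cross b ε s y₁ y z
      in just (b , (y , (z , ε))) , c , l ℕ.* 2 , 2l<2m l<m ,
         trans (ec (l ℕ.* 2)) (trans (cross-even _ _ y₁ y z l) (at-cong e₁ refl el)) ,
         trans (ec (suc (l ℕ.* 2))) (trans (cross-odd _ _ y₁ y z l)
           (at-cong e₂ (W.⟦⟧-difference {y₁} {y₂} refl) (M.translate z₂ (- + l))))
    -- The edge now leads from the second block to the first, which it enters at time `2l + 2` with
    -- coordinate `-(l + 1)`; hence the descent starts from `-1`.
    ... | b , ε , s , Fin.suc Fin.zero , e₁ , e₂ =
      let l , l<m , el = M.reach (- + 1) z₂
          y = W.⟦ + toℕ y₁ - + toℕ y₂ ⟧
          z = M.⟦ + toℕ z₁ - - + l ⟧
          c , ec = cyc-cross b ε s y₂ y z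
      in just (b , (y , (z , ε))) , c , suc (l ℕ.* 2) , 1+2l<2m l<m ,
         trans (ec (suc (l ℕ.* 2))) (trans (cross-odd _ _ y₂ y z l)
           (at-cong e₁ (W.⟦⟧-difference {y₂} {y₁} refl) (M.translate z₁ (- + l)))) ,
         trans (ec (suc l ℕ.* 2)) (trans (cross-even _ _ y₂ y z (suc l))
           (at-cong e₂ refl (trans (cong M.⟦_⟧ (sℤ (+ l))) el)))
      where
      sℤ : ∀ l → + 0 - (+ 1 + l) ≡ - + 1 - l
      sℤ = solve-∀

    product : Near (m ℕ.* 2) (suc n ℕ.* w) Blocks
    product = record { cyc = cyc ; closed = closed ; find = find ; edge = edge }

-- All numbers of cycles

Near-Fin : ℕ → ℕ → Set
Near-Fin k t = Near k t (Fin (suc (t ℕ.* k)))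

near-product : ∀ {n w m} → Frame n → Near-Fin (suc m ℕ.* 2) (suc w) → Near-Fin (suc m ℕ.* 2) (suc n ℕ.* suc w)
near-product {n} {w′} {m′} F N = near-↔ Blocks↔Fin (product (near-↔ (↔-sym (Maybe↔Fin X↔Fin)) N))
  where
  open Product {n} {w′} {m′} F
  X↔Fin : X ↔ Fin (w ℕ.* (m ℕ.* 2))
  X↔Fin = ↔-trans (↔-refl ×-↔ ↔-sym FinP.*↔×) (↔-sym FinP.*↔×)
  Blocks↔Fin : Blocks ↔ Fin (suc ((suc n ℕ.* w) ℕ.* (m ℕ.* 2)))
  Blocks↔Fin = subst (λ N → Blocks ↔ Fin (suc N)) (sym (ℕP.*-assoc (suc n) w (m ℕ.* 2)))
    (Maybe↔Fin (↔-trans (↔-refl ×-↔ X↔Fin) (↔-sym FinP.*↔×)))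

-- An odd `t` comes from one cycle and an odd frame, twice an odd number from two cycles and an odd
-- frame, and `4s` from the case `s` and `frame-four`.
near : ∀ m t → Near-Fin (suc (suc m) ℕ.* 2) t
near m′ = <-rec (Near-Fin k) go
  where
  m = suc (suc m′)
  k = m ℕ.* 2

  one : Near-Fin k 1
  one = near-↔ (Maybe↔Fin (subst (λ n → Fin k ↔ Fin n) (sym (ℕP.*-identityˡ k)) ↔-refl)) (near-one (suc m′))

  two : ∀ m → 2 ≤ m → Near-Fin (m ℕ.* 2) 2
  two m 2≤m with parity m | 2≤m
  ... | even (suc r) | _      = near-two-even r
  ... | odd (suc r)  | _      = near-two-odd r
  ... | odd zero     | s≤s ()

  4* : ∀ l → 4 ℕ.* l ≡ (l ℕ.* 2) ℕ.* 2
  4* = ℕ-Solver.solve-∀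

  go : ∀ t → (∀ {s} → s < t → Near-Fin k s) → Near-Fin k t
  go t rec with parity t
  ... | odd l = subst (Near-Fin k) (ℕP.*-identityʳ (suc (l ℕ.* 2))) (near-product {m = suc m′} (frame-odd l) one)
  ... | even l with parity l
  ... | odd h = near-product {m = suc m′} (frame-odd h) (two m (s≤s (s≤s z≤n)))
  -- For `t = 0` there is a single vertex and nothing to cover.
  ... | even zero = record
    { cyc    = λ _ ()
    ; closed = λ _ ()
    ; find   = λ { Fin.zero Fin.zero x≢i → contradiction refl x≢i }
    ; edge   = λ { Fin.zero Fin.zero x≢y → contradiction refl x≢y }
    }
  ... | even (suc s) = subst (Near-Fin k) (4* (suc s)) (near-product {m = suc m′} frame-four (rec s<t))
    where
    s<t : suc s < (suc s ℕ.* 2) ℕ.* 2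
    s<t = ℕP.<-≤-trans (ℕP.m<m*n (suc s) 2 ℕP.≤-refl) (ℕP.m≤m*n (suc s ℕ.* 2) 2)

theorem4p1 : (k u g : ℕ) → 4 ≤ k → 2 ∣ k → 1 ≤ u → ∃[ t ] u ≡ 1 ℕ.+ t ℕ.* k → 2 ≤ g →
    ARCS u g k 2
theorem4p1 _ _ (suc h) 4≤k (divides (suc (suc m)) refl) _ (t , refl) _ = Lift.arcs {suc (suc m)} {t} {h} (near m t)
theorem4p1 _ _ (suc h) (s≤s (s≤s ())) (divides 1 refl) _ _ _
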